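{- The density $\frac{64}{81}$ is not a jump for $r=3$. That is, for every $c>0$ there exists a family $\mathcal{F}$ of $3$-uniform hypergraphs whose Tur\'an density satisfies $\pi(\mathcal{F})\in\left(\frac{64}{81},\frac{64}{81}+c\right)$.
   Context: An $r$-graph is an $r$-uniform hypergraph. For a family $\mathcal{F}$ of $r$-graphs, $\mathrm{ex}(n,\mathcal{F})$ is the maximum number of edges in an $r$-graph on $n$ vertices containing no member of $\mathcal{F}$ as a subgraph, and the Tur\'an density is $\pi(\mathcal{F})=\lim_{n\to\infty}\mathrm{ex}(n,\mathcal{F})/\binom{n}{r}$ (this limit exists). A number $\alpha\in[0,1)$ is a jump for $r$ if there exists $c>0$ (depending on $\alpha$ and $r$) such that no family $\mathcal{F}$ of $r$-graphs has $\pi(\mathcal{F})\in(\alpha,\alpha+c)$. -}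

module Defs where

open import Data.Nat as ℕ using (ℕ)
open import Data.Nat.Combinatorics using (_C_)
open import Data.Integer using (+_)
open import Data.Rational using (ℚ; _/_; _≤_; _*_)
open import Data.Fin using (Fin; _<_)
open import Data.Product using (Σ; ∃; _×_; _,_)
open import Data.Sum using (_⊎_)
open import Data.List using (List; length)
open import Data.List.Membership.Propositional using (_∈_)
open import Data.List.Relation.Unary.All using (All)
open import Data.List.Relation.Unary.Unique.Propositional using (Unique)
open import Function.Definitions using (Injective)
open import Relation.Binary.PropositionalEquality using (_≡_)
open import Relation.Nullary using (¬_)
open import Level using (suc; zero)

-- A triple (x , y , z) of vertices; as an edge it stands for the 3-set {x,y,z}.
Triple : ℕ → Set
Triple n = Fin n × Fin n × Fin n

-- Edges are stored in increasing order, so each 3-set has one representation.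
Increasing : ∀ {n} → Triple n → Set
Increasing (x , y , z) = (x < y) × (y < z)

record Graph3 (n : ℕ) : Set where
  field
    edges      : List (Triple n)
    increasing : All Increasing edges
    unique     : Unique edges
open Graph3 public

∣E∣ : ∀ {n} → Graph3 n → ℕ
∣E∣ G = length (edges G)

_∈₃_ : ∀ {n} → Fin n → Triple n → Set
v ∈₃ (x , y , z) = (v ≡ x) ⊎ (v ≡ y) ⊎ (v ≡ z)

-- the 3-set {a,b,c} (of distinct vertices) is an edge of G
IsEdge : ∀ {n} → Graph3 n → Fin n → Fin n → Fin n → Set
IsEdge G a b c = ∃ λ e → (e ∈ edges G) × (a ∈₃ e) × (b ∈₃ e) × (c ∈₃ e)

_⊆G_ : ∀ {m n} → Graph3 m → Graph3 n → Set
_⊆G_ {m} {n} H G =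
  Σ (Fin m → Fin n) λ φ → Injective _≡_ _≡_ φ ×
    All (λ { (x , y , z) → IsEdge G (φ x) (φ y) (φ z) }) (edges H)

Family : Set₁
Family = (m : ℕ) → Graph3 m → Set

Free : ∀ {n} → Family → Graph3 n → Set
Free {n} 𝓕 G = ¬ (Σ ℕ λ m → Σ (Graph3 m) λ H → 𝓕 m H × (H ⊆G G))

ℕ→ℚ : ℕ → ℚ
ℕ→ℚ k = + k / 1

-- "ex(n,𝓕) / C(n,3) ∈ [a , b]", stated without computing ex:
-- some 𝓕-free 3-graph on n vertices has ≥ a·C(n,3) edges, and
-- every 𝓕-free 3-graph on n vertices has ≤ b·C(n,3) edges.
ExDensityIn : Family → ℕ → ℚ → ℚ → Set
ExDensityIn 𝓕 n a b =
  (Σ (Graph3 n) λ G → Free 𝓕 G × (a * ℕ→ℚ (n C 3) ≤ ℕ→ℚ (∣E∣ G)))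
  × ((G : Graph3 n) → Free 𝓕 G → ℕ→ℚ (∣E∣ G) ≤ b * ℕ→ℚ (n C 3))

-- π(𝓕) ∈ (α , β): since the limit π(𝓕) = lim ex(n,𝓕)/C(n,3) exists, this is
-- equivalent to: there are rationals α < a < b < β with
-- ex(n,𝓕)/C(n,3) ∈ [a , b] for all sufficiently large n.
TuranDensityIn : Family → ℚ → ℚ → Set
TuranDensityIn 𝓕 α β =
  Σ ℚ λ a → Σ ℚ λ b →
    (α Data.Rational.< a) × (a Data.Rational.< b) × (b Data.Rational.< β) ×
    Σ ℕ λ n₀ → (n : ℕ) → n₀ ℕ.≤ n → ExDensityIn 𝓕 n a b

{-# OPTIONS --safe #-}
module Submission where

-- The pattern {AAB, ABB, AAC, ABC, BBC} has blow-ups of density 64/81, attained at part sizes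
-- 4 : 4 : 1, and no blow-up is denser. Fix k and split A and B into 4m labels each. Asking edges to
-- use distinct labels loses O(1/m) of the density; adding inside A a 3-graph M on the labels with
-- sufficiently many, Θ(m²), edges more than makes up for it. If M is so sparse that any 2 + s labels
-- span at most s of its edges for all s ≤ k (deletion method), this gain is invisible locally: on k
-- vertices with label weights α₁ ≥ α₂ ≥ …, a layer-cake argument bounds the gain by
-- α₁α₂(α₃ + α₄ + …), which the loss of at least (α₁² + α₂²)/2 per vertex outside A pays for, so k
-- vertices never span more than (64/81)k³/6 edges. Forbidding all 3-graphs on k vertices with more
-- edges than that gives a density above 64/81, and at most 64/81 + O(1/k) by averaging.

open import Defs
open import Data.Bool.Base using (Bool; true; false; T; _∧_; _∨_; not; if_then_else_)
open import Data.Bool.Properties using () renaming (_≟_ to _≟ᵇ_)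
open import Data.Empty using (⊥; ⊥-elim)
open import Data.Fin.Base as Fin
  using (Fin; zero; suc; toℕ; punchIn; _↑ˡ_; _↑ʳ_; combine; remQuot; splitAt; quotient; remainder)
import Data.Fin.Properties as Fin
open import Data.List.Base using (List; []; _∷_; length; filter; cartesianProduct; allFin)
open import Data.List.Membership.Propositional using (_∈_)
open import Data.List.Membership.Propositional.Properties
  using (∈-cartesianProduct⁺; ∈-allFin; ∈-filter⁺; ∈-filter⁻)
open import Data.List.Relation.Unary.All as All using (All; []; _∷_)
open import Data.List.Relation.Unary.AllPairs using ([]; _∷_)
open import Data.List.Relation.Unary.Any using (here; there)
open import Data.List.Relation.Unary.Unique.Propositional using (Unique)
import Data.List.Relation.Unary.Unique.Propositional.Properties as Unique
open import Data.Nat.Base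
open import Data.Nat.Combinatorics using (_C_; nC1≡n; nCk+nC[k+1]≡[n+1]C[k+1])
open import Data.Nat.DivMod as DivMod using (_%_; m≡m%n+[m/n]*n; m%n<n)
open import Data.Nat.Properties
open import Data.Nat.Tactic.RingSolver using (solve-∀)
open import Data.Product using (Σ; ∃; _×_; _,_; proj₁; proj₂)
open import Data.Sum using (_⊎_; inj₁; inj₂; [_,_]′)
open import Data.Unit using (⊤)
open import Data.Vec.Base using (Vec; []; _∷_)
import Data.Vec.Functional as Vector
open import Function.Base using (_∘_; id; case_of_)
open import Function.Definitions using (Injective)
open import Relation.Binary.Definitions using (tri<; tri≈; tri>)
open import Relation.Binary.PropositionalEquality
open import Relation.Nullary using (¬_; yes; no; does; contradiction)
open import Algebra.Properties.Semiring.Sum +-*-semiring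
  using (sum; sum-syntax; ∑-distrib-+; ∑-comm; *-distribˡ-sum; *-distribʳ-sum; sum-remove; sum-cong-≗)

-- Finite sums

-- Loss and gain are both of order m², and the sparsity condition on M sits exactly at the threshold
-- where this is possible. If triples are kept with probability of order 1/m, about m^(2+s) ·
-- m^-(s+1) = m choices of 2 + s labels span more than s of them, for every s alike; deleting
-- everything inside them is negligible against Θ(m²) triples. Asking for at most s - 1 would forbid
-- every single triple at s = 1. In the other direction s is just small enough: the two heaviest
-- labels are free and every further label pays for one triple, so that the gain is α₁α₂ times the
-- weight of the further labels. The surplus density is only 1/(243m), where m must be large in
-- terms of k, but nothing beyond its positivity matters. The given c constrains k alone, through
-- the O(1/k) of averaging. All counting is done in ℕ with denominators cleared:
-- `486 * t ≤ 64 * k ³` is t ≤ (64/81)k³/6, differences are moved to the other side, and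
-- probabilities stay unnormalised.

𝟙 : Bool → ℕ
𝟙 b = if b then 1 else 0

𝟙≤1 : ∀ b → 𝟙 b ≤ 1
𝟙≤1 true  = ≤-refl
𝟙≤1 false = z≤n

𝟙-∧ : ∀ a b → 𝟙 (a ∧ b) ≡ 𝟙 a * 𝟙 b
𝟙-∧ true  b = sym (+-identityʳ (𝟙 b))
𝟙-∧ false b = refl

𝟙-mono : ∀ {a b} → (a ≡ true → b ≡ true) → 𝟙 a ≤ 𝟙 b
𝟙-mono {false}     f = z≤n
𝟙-mono {true}  {b} f rewrite f refl = ≤-refl

∑-mono : ∀ {n} {f g : Fin n → ℕ} → (∀ i → f i ≤ g i) → sum f ≤ sum g
∑-mono {zero}  h = z≤n
∑-mono {suc n} h = +-mono-≤ (h zero) (∑-mono (h ∘ suc))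

∑-const : ∀ n c → ∑[ i < n ] c ≡ n * c
∑-const zero    c = refl
∑-const (suc n) c = cong (c +_) (∑-const n c)

∑-zero : ∀ {n} {f : Fin n → ℕ} → (∀ i → f i ≡ 0) → sum f ≡ 0
∑-zero {n} h = trans (sum-cong-≗ h) (trans (∑-const n 0) (*-zeroʳ n))

∑-*ˡ : ∀ {n} c (f : Fin n → ℕ) → ∑[ i < n ] (c * f i) ≡ c * sum f
∑-*ˡ c f = sym (*-distribˡ-sum c f)

∑-*ʳ : ∀ {n} c (f : Fin n → ℕ) → ∑[ i < n ] (f i * c) ≡ sum f * c
∑-*ʳ c f = sym (*-distribʳ-sum c f)

term≤∑ : ∀ {n} (f : Fin n → ℕ) i → f i ≤ sum f
term≤∑ f zero    = m≤m+n _ _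
term≤∑ f (suc i) = ≤-trans (term≤∑ (f ∘ suc) i) (m≤n+m _ _)

∑-split : ∀ m {n} (f : Fin (m + n) → ℕ) →
          sum f ≡ ∑[ i < m ] f (i ↑ˡ n) + ∑[ j < n ] f (m ↑ʳ j)
∑-split zero    f = refl
∑-split (suc m) f =
  trans (cong (f zero +_) (∑-split m (f ∘ suc))) (sym (+-assoc (f zero) _ _))

∑-combine : ∀ m n (f : Fin (m * n) → ℕ) →
            sum f ≡ ∑[ i < m ] ∑[ j < n ] f (combine i j)
∑-combine zero    n f = refl
∑-combine (suc m) n f =
  trans (∑-split n f) (cong (∑[ j < n ] f (j ↑ˡ (m * n)) +_) (∑-combine m n (f ∘ (n ↑ʳ_))))

_==_ : ∀ {n} → Fin n → Fin n → Bool
u == v = does (u Fin.≟ v)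

==-refl : ∀ {n} (u : Fin n) → (u == u) ≡ true
==-refl u with u Fin.≟ u
... | yes _ = refl
... | no ¬p = contradiction refl ¬p

==⇒≡ : ∀ {n} (u v : Fin n) → (u == v) ≡ true → u ≡ v
==⇒≡ u v p with u Fin.≟ v
... | yes q = q

≢⇒== : ∀ {n} {u v : Fin n} → u ≢ v → (u == v) ≡ false
≢⇒== {u = u} {v} p with u Fin.≟ v
... | yes q = contradiction q p
... | no _  = refl

∑-δ : ∀ {n} (f : Fin n → ℕ) i → ∑[ u < n ] (f u * 𝟙 (u == i)) ≡ f i
∑-δ {suc n} f zero    = trans (cong₂ _+_ (*-identityʳ (f zero)) (∑-zero (λ u → *-zeroʳ (f (suc u))))) (+-identityʳ _)
∑-δ {suc n} f (suc i) = trans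
  (cong₂ _+_ (*-zeroʳ (f zero)) refl)
  (∑-δ (f ∘ suc) i)

Σ³ : ∀ {n} → (Fin n → Fin n → Fin n → ℕ) → ℕ
Σ³ {n} f = ∑[ x < n ] ∑[ y < n ] ∑[ z < n ] f x y z

Σ³-mono : ∀ {n} {f g : Fin n → Fin n → Fin n → ℕ} →
          (∀ x y z → f x y z ≤ g x y z) → Σ³ f ≤ Σ³ g
Σ³-mono h = ∑-mono λ x → ∑-mono λ y → ∑-mono λ z → h x y z

Σ³-cong : ∀ {n} {f g : Fin n → Fin n → Fin n → ℕ} →
          (∀ x y z → f x y z ≡ g x y z) → Σ³ f ≡ Σ³ g
Σ³-cong h = sum-cong-≗ λ x → sum-cong-≗ λ y → sum-cong-≗ λ z → h x y z

Σ³-*ˡ : ∀ {n} c (f : Fin n → Fin n → Fin n → ℕ) → Σ³ (λ x y z → c * f x y z) ≡ c * Σ³ f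
Σ³-*ˡ {n} c f = trans
  (sum-cong-≗ λ x → trans (sum-cong-≗ λ y → ∑-*ˡ c (f x y)) (∑-*ˡ c (λ y → sum (f x y))))
  (∑-*ˡ c (λ x → ∑[ y < n ] sum (f x y)))

Σ³-+ : ∀ {n} (f g : Fin n → Fin n → Fin n → ℕ) →
       Σ³ (λ x y z → f x y z + g x y z) ≡ Σ³ f + Σ³ g
Σ³-+ {n} f g = trans
  (sum-cong-≗ λ x → trans (sum-cong-≗ λ y → ∑-distrib-+ (f x y) (g x y))
                          (∑-distrib-+ (λ y → sum (f x y)) (λ y → sum (g x y))))
  (∑-distrib-+ (λ x → ∑[ y < n ] sum (f x y)) (λ x → ∑[ y < n ] sum (g x y)))

∑-Σ³-comm : ∀ {m n} (f : Fin m → Fin n → Fin n → Fin n → ℕ) →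
            ∑[ i < m ] Σ³ (f i) ≡ Σ³ (λ x y z → ∑[ i < m ] f i x y z)
∑-Σ³-comm {m} {n} f = trans (∑-comm λ i x → ∑[ y < n ] ∑[ z < n ] f i x y z)
  (sum-cong-≗ λ x → trans (∑-comm λ i y → ∑[ z < n ] f i x y z)
  (sum-cong-≗ λ y → ∑-comm λ i z → f i x y z))

Σ³-product : ∀ {n} (f g h : Fin n → ℕ) → Σ³ (λ x y z → f x * (g y * h z)) ≡ sum f * (sum g * sum h)
Σ³-product {n} f g h = trans
  (sum-cong-≗ λ x → trans
    (sum-cong-≗ λ y → trans (∑-*ˡ (f x) (λ z → g y * h z)) (cong (f x *_) (∑-*ˡ (g y) h)))
    (trans (∑-*ˡ (f x) (λ y → g y * sum h)) (cong (f x *_) (∑-*ʳ (sum h) g))))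
  (∑-*ʳ (sum g * sum h) f)

-- Averaging over k-subsets

==-sym : ∀ {n} (u v : Fin n) → (u == v) ≡ (v == u)
==-sym u v with u Fin.≟ v
... | yes refl = sym (==-refl u)
... | no u≢v   = sym (≢⇒== (u≢v ∘ sym))

∑-δ′ : ∀ {n} (x : Fin n) → ∑[ v < n ] 𝟙 (x == v) ≡ 1
∑-δ′ x = trans (sum-cong-≗ λ v → trans (cong 𝟙 (==-sym x v)) (sym (+-identityʳ _))) (∑-δ (λ _ → 1) x)

Relation₃ : ℕ → Set
Relation₃ n = Fin n → Fin n → Fin n → Bool

IsIncreasing : ∀ {n} → Relation₃ n → Set
IsIncreasing E = ∀ x y z → E x y z ≡ true → x Fin.< y × y Fin.< z

pull : ∀ {k} {X : Set} → (X → X → X → Bool) → (Fin k → X) → Relation₃ k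
pull E φ x y z = E (φ x) (φ y) (φ z)

# : ∀ {n} → Relation₃ n → ℕ
# E = Σ³ λ x y z → 𝟙 (E x y z)

StrictlyMonotone : ∀ {k n} → (Fin k → Fin n) → Set
StrictlyMonotone φ = ∀ x y → x Fin.< y → φ x Fin.< φ y

punchIn-monotone : ∀ {n} (v : Fin (suc n)) → StrictlyMonotone (punchIn v)
punchIn-monotone v x y x<y = ≰⇒> λ p → <⇒≱ x<y (Fin.punchIn-cancel-≤ v y x p)

∑-punchIn : ∀ {n} (f : Fin (suc n) → ℕ) v →
            ∑[ x < n ] f (punchIn v x) ≡ ∑[ x < suc n ] (f x * 𝟙 (not (x == v)))
∑-punchIn {n} f v = +-cancelˡ-≡ (f v) _ _ (begin
  f v + ∑[ x < n ] f (punchIn v x)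
    ≡⟨ sum-remove {i = v} f ⟨
  sum f
    ≡⟨ sum-cong-≗ (λ x → split (f x) (x == v)) ⟩
  ∑[ x < suc n ] (f x * 𝟙 (x == v) + f x * 𝟙 (not (x == v)))
    ≡⟨ ∑-distrib-+ (λ x → f x * 𝟙 (x == v)) (λ x → f x * 𝟙 (not (x == v))) ⟩
  ∑[ x < suc n ] (f x * 𝟙 (x == v)) + ∑[ x < suc n ] (f x * 𝟙 (not (x == v)))
    ≡⟨ cong (_+ ∑[ x < suc n ] (f x * 𝟙 (not (x == v)))) (∑-δ f v) ⟩
  f v + ∑[ x < suc n ] (f x * 𝟙 (not (x == v))) ∎)
  where
  open ≡-Reasoning
  split : ∀ a b → a ≡ a * 𝟙 b + a * 𝟙 (not b)
  split a true  = sym (trans (cong (a * 1 +_) (*-zeroʳ a)) (trans (+-identityʳ _) (*-identityʳ a)))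
  split a false = sym (trans (cong (_+ a * 1) (*-zeroʳ a)) (*-identityʳ a))

≠ : ∀ {n} → Fin n → Fin n → ℕ
≠ v x = 𝟙 (not (x == v))

Σ³-punchIn : ∀ {n} (f : Fin (suc n) → Fin (suc n) → Fin (suc n) → ℕ) v →
  Σ³ (λ x y z → f (punchIn v x) (punchIn v y) (punchIn v z)) ≡
  Σ³ (λ x y z → f x y z * (≠ v x * (≠ v y * ≠ v z)))
Σ³-punchIn {n} f v = begin
  Σ³ (λ x y z → f (punchIn v x) (punchIn v y) (punchIn v z))
    ≡⟨ sum-cong-≗ (λ x → trans
         (sum-cong-≗ λ y → ∑-punchIn (λ z → f (punchIn v x) (punchIn v y) z) v)
         (∑-punchIn (λ y → ∑[ z < suc n ] (f (punchIn v x) y z * ≠ v z)) v)) ⟩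
  ∑[ x < n ] ∑[ y < suc n ] (∑[ z < suc n ] (f (punchIn v x) y z * ≠ v z) * ≠ v y)
    ≡⟨ ∑-punchIn (λ x → ∑[ y < suc n ] (∑[ z < suc n ] (f x y z * ≠ v z) * ≠ v y)) v ⟩
  ∑[ x < suc n ] (∑[ y < suc n ] (∑[ z < suc n ] (f x y z * ≠ v z) * ≠ v y) * ≠ v x)
    ≡⟨ sum-cong-≗ (λ x → trans
         (sym (∑-*ʳ (≠ v x) (λ y → ∑[ z < suc n ] (f x y z * ≠ v z) * ≠ v y)))
         (sum-cong-≗ λ y → trans
           (cong (_* ≠ v x) (sym (∑-*ʳ (≠ v y) (λ z → f x y z * ≠ v z))))
           (trans (sym (∑-*ʳ (≠ v x) (λ z → f x y z * ≠ v z * ≠ v y)))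
             (sum-cong-≗ λ z → rearrange (f x y z) (≠ v z) (≠ v y) (≠ v x))))) ⟩
  Σ³ (λ x y z → f x y z * (≠ v x * (≠ v y * ≠ v z))) ∎
  where
  open ≡-Reasoning
  rearrange : ∀ a b c d → a * b * c * d ≡ a * (d * (c * b))
  rearrange = solve-∀

∑-avoiding : ∀ {n} {x y z : Fin n} → x ≢ y → x ≢ z → y ≢ z →
             ∑[ v < n ] (≠ v x * (≠ v y * ≠ v z)) + 3 ≡ n
∑-avoiding {n} {x} {y} {z} x≢y x≢z y≢z = begin
  ∑[ v < n ] p v + 3
    ≡⟨ cong₂ (λ a b → ∑[ v < n ] p v + (a + b)) (sym (∑-δ′ x))
         (cong₂ _+_ (sym (∑-δ′ y)) (sym (∑-δ′ z))) ⟩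
  ∑[ v < n ] p v + (∑[ v < n ] 𝟙 (x == v) + (∑[ v < n ] 𝟙 (y == v) + ∑[ v < n ] 𝟙 (z == v)))
    ≡⟨ cong (λ s → ∑[ v < n ] p v + (∑[ v < n ] 𝟙 (x == v) + s))
         (∑-distrib-+ (λ v → 𝟙 (y == v)) (λ v → 𝟙 (z == v))) ⟨
  ∑[ v < n ] p v + (∑[ v < n ] 𝟙 (x == v) + ∑[ v < n ] (𝟙 (y == v) + 𝟙 (z == v)))
    ≡⟨ cong (∑[ v < n ] p v +_) (∑-distrib-+ (λ v → 𝟙 (x == v)) (λ v → 𝟙 (y == v) + 𝟙 (z == v))) ⟨
  ∑[ v < n ] p v + ∑[ v < n ] (𝟙 (x == v) + (𝟙 (y == v) + 𝟙 (z == v)))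
    ≡⟨ ∑-distrib-+ p (λ v → 𝟙 (x == v) + (𝟙 (y == v) + 𝟙 (z == v))) ⟨
  ∑[ v < n ] (p v + (𝟙 (x == v) + (𝟙 (y == v) + 𝟙 (z == v))))
    ≡⟨ sum-cong-≗ one ⟩
  ∑[ v < n ] 1
    ≡⟨ trans (∑-const n 1) (*-identityʳ n) ⟩
  n ∎
  where
  open ≡-Reasoning
  p : Fin n → ℕ
  p v = ≠ v x * (≠ v y * ≠ v z)
  one : ∀ v → p v + (𝟙 (x == v) + (𝟙 (y == v) + 𝟙 (z == v))) ≡ 1
  one v with x Fin.≟ v | y Fin.≟ v | z Fin.≟ v
  ... | yes refl | yes refl | _        = contradiction refl x≢y
  ... | yes refl | no _     | yes refl = contradiction refl x≢z
  ... | yes _    | no _     | no _     = refl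
  ... | no _     | yes refl | yes refl = contradiction refl y≢z
  ... | no _     | yes _    | no _     = refl
  ... | no _     | no _     | yes _    = refl
  ... | no _     | no _     | no _     = refl

-- Double counting of pairs of an edge and a deleted vertex: an edge survives unless one of its own
-- three vertices goes. `IsIncreasing` provides the distinctness of the three.
∑-vertex-deletion : ∀ {n} (E : Relation₃ (suc n)) → IsIncreasing E →
  ∑[ v < suc n ] # (pull E (punchIn v)) + # E * 3 ≡ # E * suc n
∑-vertex-deletion {n} E inc = begin
  ∑[ v < suc n ] # (pull E (punchIn v)) + # E * 3
    ≡⟨ cong₂ _+_ (trans (sum-cong-≗ (Σ³-punchIn (λ x y z → 𝟙 (E x y z))))
                        (trans (∑-Σ³-comm λ v x y z → 𝟙 (E x y z) * (≠ v x * (≠ v y * ≠ v z)))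
                               (Σ³-cong λ x y z → ∑-*ˡ (𝟙 (E x y z)) (avoid x y z))))
                 (trans (*-comm (# E) 3) (sym (Σ³-*ˡ 3 (λ x y z → 𝟙 (E x y z))))) ⟩
  Σ³ (λ x y z → 𝟙 (E x y z) * sum (avoid x y z)) + Σ³ (λ x y z → 3 * 𝟙 (E x y z))
    ≡⟨ Σ³-+ (λ x y z → 𝟙 (E x y z) * sum (avoid x y z)) (λ x y z → 3 * 𝟙 (E x y z)) ⟨
  Σ³ (λ x y z → 𝟙 (E x y z) * sum (avoid x y z) + 3 * 𝟙 (E x y z))
    ≡⟨ Σ³-cong each ⟩
  Σ³ (λ x y z → suc n * 𝟙 (E x y z))
    ≡⟨ trans (Σ³-*ˡ (suc n) (λ x y z → 𝟙 (E x y z))) (*-comm (suc n) (# E)) ⟩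
  # E * suc n ∎
  where
  open ≡-Reasoning
  avoid : Fin (suc n) → Fin (suc n) → Fin (suc n) → Fin (suc n) → ℕ
  avoid x y z v = ≠ v x * (≠ v y * ≠ v z)
  each : ∀ x y z → 𝟙 (E x y z) * sum (avoid x y z) + 3 * 𝟙 (E x y z) ≡ suc n * 𝟙 (E x y z)
  each x y z with E x y z in eq
  ... | false = sym (*-zeroʳ n)
  ... | true with x<y , y<z ← inc x y z eq =
    trans (cong (_+ 3) (+-identityʳ _))
      (trans (∑-avoiding (Fin.<⇒≢ x<y) (Fin.<⇒≢ (<-trans x<y y<z)) (Fin.<⇒≢ y<z))
             (sym (*-identityʳ (suc n))))

-- A graph's density is the average of the densities of its vertex-deleted subgraphs, so a bound on
-- k vertices passes up to n by induction. Writing k = 3 + κ and n = j + k keeps the falling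
-- factorials free of truncated subtraction.
averaging : ∀ κ M j (E : Relation₃ (j + (3 + κ))) → IsIncreasing E →
  (∀ (φ : Fin (3 + κ) → Fin (j + (3 + κ))) → StrictlyMonotone φ → # (pull E φ) ≤ M) →
  # E * ((3 + κ) * (2 + κ) * (1 + κ)) ≤ M * ((j + (3 + κ)) * (j + (2 + κ)) * (j + (1 + κ)))
averaging κ M zero    E inc local = *-monoˡ-≤ ((3 + κ) * (2 + κ) * (1 + κ)) (local id (λ _ _ p → p))
-- The cancelled factor `j + (1 + κ)` is the number of vertices outside an edge: the double count
-- produces it on the left, and it is the last factor of the falling factorial for the smaller graph
-- on the right.
averaging κ M (suc j) E inc local = *-cancelʳ-≤ _ _ (j + (1 + κ)) {{>-nonZero (≤-trans z<s (m≤n+m (1 + κ) j))}} (begin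
  # E * K * (j + (1 + κ))
    ≡⟨ *-assoc-comm (# E) K (j + (1 + κ)) ⟩
  # E * (j + (1 + κ)) * K
    ≡⟨ cong (_* K) deletion ⟩
  ∑[ v < suc n ] # (pull E (punchIn v)) * K
    ≡⟨ ∑-*ʳ K (λ v → # (pull E (punchIn v))) ⟨
  ∑[ v < suc n ] (# (pull E (punchIn v)) * K)
    ≤⟨ ∑-mono (λ v → averaging κ M j (pull E (punchIn v))
         (λ x y z p → let q , r = inc _ _ _ p in cancel v x y q , cancel v y z r)
         (λ φ φ↑ → local (punchIn v ∘ φ) λ x y p → punchIn-monotone v _ _ (φ↑ x y p))) ⟩
  ∑[ v < suc n ] (M * (n * (j + (2 + κ)) * (j + (1 + κ))))
    ≡⟨ ∑-const (suc n) _ ⟩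
  suc n * (M * (n * (j + (2 + κ)) * (j + (1 + κ))))
    ≡⟨ shuffle (suc n) M n (j + (2 + κ)) (j + (1 + κ)) ⟩
  M * (suc n * n * (j + (2 + κ))) * (j + (1 + κ))
    ≡⟨ cong₂ (λ p q → M * (suc n * p * q) * (j + (1 + κ))) (+-suc j (2 + κ)) (+-suc j (1 + κ)) ⟩
  M * ((suc j + (3 + κ)) * (suc j + (2 + κ)) * (suc j + (1 + κ))) * (j + (1 + κ)) ∎)
  where
  open ≤-Reasoning
  n K : ℕ
  n = j + (3 + κ)
  K = (3 + κ) * (2 + κ) * (1 + κ)
  *-assoc-comm : ∀ a b c → a * b * c ≡ a * c * b
  *-assoc-comm = solve-∀
  shuffle : ∀ a b c d e → a * (b * (c * d * e)) ≡ b * (a * c * d) * e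
  shuffle = solve-∀
  arith : ∀ t j κ → t * (1 + (j + (3 + κ))) ≡ t * (j + (1 + κ)) + t * 3
  arith = solve-∀
  deletion : # E * (j + (1 + κ)) ≡ ∑[ v < suc n ] # (pull E (punchIn v))
  deletion = +-cancelʳ-≡ (# E * 3) _ _
    (sym (trans (∑-vertex-deletion E inc) (arith (# E) j κ)))
  cancel : ∀ v (x y : Fin n) → punchIn v x Fin.< punchIn v y → x Fin.< y
  cancel v x y p = ≰⇒> λ q → <⇒≱ p (Fin.punchIn-mono-≤ v y x q)

-- The density inequality on few vertices

am-gm : ∀ x y → 2 * (x * y) ≤ x * x + y * y
am-gm x y with ≤-total x y
... | inj₁ x≤y with d , refl ← m≤n⇒∃[o]m+o≡n x≤y = ≤-trans (m≤m+n _ (d * d)) (≤-reflexive (eq x d))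
  where
  eq : ∀ x d → 2 * (x * (x + d)) + d * d ≡ x * x + (x + d) * (x + d)
  eq = solve-∀
... | inj₂ y≤x with d , refl ← m≤n⇒∃[o]m+o≡n y≤x = ≤-trans (m≤m+n _ (d * d)) (≤-reflexive (eq y d))
  where
  eq : ∀ y d → 2 * ((y + d) * y) + d * d ≡ (y + d) * (y + d) + y * y
  eq = solve-∀

-- The device by which polynomial inequalities are certified: the goal has the same difference as a
-- known inequality, b - a = y′ - y, and without minus signs this is an identity for the ring
-- solver.
≤-exchange : ∀ {a b} y y′ → y ≤ y′ → a + y′ ≡ b + y → a ≤ b
≤-exchange {a} {b} y y′ y≤y′ eq =
  +-cancelʳ-≤ y a b (≤-trans (+-monoʳ-≤ a y≤y′) (≤-reflexive eq))

-- 3Ψ is six times the Lagrange polynomial of the pattern {AAB, ABB, AAC, ABC, BBC}, so that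
-- Ψ-bound says that its blow-ups have density at most 64/81.
Ψ : ℕ → ℕ → ℕ → ℕ
Ψ a b c = a * a * b + a * (b * b) + a * a * c + 2 * (a * b * c) + b * b * c

infixl 9 _³
_³ : ℕ → ℕ
n ³ = n * n * n

4ab≤[a+b]² : ∀ a b → 4 * (a * b) ≤ (a + b) * (a + b)
4ab≤[a+b]² a b = ≤-exchange (2 * (a * b)) (a * a + b * b) (am-gm a b) (eq a b)
  where
  eq : ∀ a b → 4 * (a * b) + (a * a + b * b) ≡ (a + b) * (a + b) + 2 * (a * b)
  eq = solve-∀

-- The difference of the two sides is (s − 8c)² (13s + 4c).
cubic-bound : ∀ s c → 243 * s * (s * s) + 972 * (s * s * c) ≤ 256 * (s + c) ³
cubic-bound s c = ≤-exchange _ _ (*-monoˡ-≤ (13 * s + 4 * c) (am-gm s (8 * c))) (eq s c)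
  where
  eq : ∀ s c → 243 * s * (s * s) + 972 * (s * s * c) + (s * s + 8 * c * (8 * c)) * (13 * s + 4 * c) ≡
               256 * ((s + c) * (s + c) * (s + c)) + 2 * (s * (8 * c)) * (13 * s + 4 * c)
  eq = solve-∀

-- Ψ equals ab(a + b) + (a + b)²c, so for fixed s = a + b it is largest at a = b. The remaining
-- cubic in s and c is extremal at s = 8c, which gives the sizes 4 : 4 : 1.
Ψ-bound : ∀ a b c → 243 * Ψ a b c ≤ 64 * (a + b + c) ³
Ψ-bound a b c = *-cancelˡ-≤ 4 (begin
  4 * (243 * Ψ a b c)                                          ≡⟨ eq a b c ⟩
  243 * s * (4 * (a * b)) + 972 * (s * s * c)                  ≤⟨ +-monoˡ-≤ _ (*-monoʳ-≤ (243 * s) (4ab≤[a+b]² a b)) ⟩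
  243 * s * (s * s) + 972 * (s * s * c)                        ≤⟨ cubic-bound s c ⟩
  256 * (s + c) ³                                              ≡⟨ *-assoc 4 64 ((s + c) ³) ⟩
  4 * (64 * (s + c) ³)                                         ∎)
  where
  open ≤-Reasoning
  s : ℕ
  s = a + b
  eq : ∀ a b c → 4 * (243 * (a * a * b + a * (b * b) + a * a * c + 2 * (a * b * c) + b * b * c)) ≡
       243 * (a + b) * (4 * (a * b)) + 972 * ((a + b) * (a + b) * c)
  eq = solve-∀

-- Far from the sharp constant 27: the cube contains 6xyz, and one use of `am-gm` on its terms 3z(x²
-- + y²) yields 6xyz more. The application needs 486/64, which is less than 8.
12xyz≤[x+y+z]³ : ∀ x y z → 12 * (x * y * z) ≤ (x + y + z) ³
12xyz≤[x+y+z]³ x y z = ≤-exchange (3 * z * (2 * (x * y))) (3 * z * (x * x + y * y) + R)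
  (≤-trans (*-monoʳ-≤ (3 * z) (am-gm x y)) (m≤m+n _ R)) (eq x y z)
  where
  R = x * x * x + y * y * y + z * z * z + 3 * (x * x * y) + 3 * (x * y * y) + 3 * (x * z * z) + 3 * (y * z * z)
  eq : ∀ x y z → 12 * (x * y * z) + (3 * z * (x * x + y * y) + (x * x * x + y * y * y + z * z * z + 3 * (x * x * y) + 3 * (x * y * y) + 3 * (x * z * z) + 3 * (y * z * z))) ≡
               (x + y + z) * (x + y + z) * (x + y + z) + 3 * z * (2 * (x * y))
  eq = solve-∀

-- 26b² − 165bc + 321c² is positive definite.
165bc≤26b²+321c² : ∀ b c → 165 * (b * c) ≤ 26 * (b * b) + 321 * (c * c)
165bc≤26b²+321c² b c = ≤-exchange (2 * (5 * b * (16 * c)) + 2 * (b * (3 * c)))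
  (5 * b * (5 * b) + 16 * c * (16 * c) + (b * b + 3 * c * (3 * c)) + (b * c + 56 * (c * c)))
  (≤-trans (+-mono-≤ (am-gm (5 * b) (16 * c)) (am-gm b (3 * c))) (m≤m+n _ _))
  (eq b c)
  where
  eq : ∀ b c → 165 * (b * c) + (5 * b * (5 * b) + 16 * c * (16 * c) + (b * b + 3 * c * (3 * c)) + (b * c + 56 * (c * c))) ≡
       26 * (b * b) + 321 * (c * c) + (2 * (5 * b * (16 * c)) + 2 * (b * (3 * c)))
  eq = solve-∀

-- A stability version of `Ψ-bound`: when A outweighs B and C together by d, the pattern misses the
-- optimum by an amount cubic in d. The only negative coefficient of the difference is that of
-- -165b²c, which 26b³ and 321bc² absorb.
Ψ-excess-bound : ∀ b c d → 243 * Ψ (b + c + d) b c + 64 * d ³ ≤ 64 * (b + c + d + b + c) ³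
Ψ-excess-bound b c d = ≤-exchange (b * (165 * (b * c))) (b * (26 * (b * b) + 321 * (c * c)) + R)
  (≤-trans (*-monoʳ-≤ b (165bc≤26b²+321c² b c)) (m≤m+n _ R)) (eq b c d)
  where
  R = 269 * (c * c * c) + d * (39 * (b * b) + 78 * (b * c) + 282 * (c * c)) + 141 * (d * d * (b + c))
  eq : ∀ b c d →
    243 * ((b + c + d) * (b + c + d) * b + (b + c + d) * (b * b) + (b + c + d) * (b + c + d) * c + 2 * ((b + c + d) * b * c) + b * b * c)
    + 64 * (d * d * d) + (b * (26 * (b * b) + 321 * (c * c)) + (269 * (c * c * c) + d * (39 * (b * b) + 78 * (b * c) + 282 * (c * c)) + 141 * (d * d * (b + c)))) ≡
    64 * ((b + c + d + b + c) * (b + c + d + b + c) * (b + c + d + b + c)) + b * (165 * (b * c))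
  eq = solve-∀

T⇒true : ∀ {b} → T b → b ≡ true
T⇒true {true} _ = refl

true⇒T : ∀ {b} → b ≡ true → T b
true⇒T refl = _

<⇒<ᵇ-true : ∀ {m n} → m < n → (m <ᵇ n) ≡ true
<⇒<ᵇ-true = T⇒true ∘ <⇒<ᵇ

<ᵇ-true⇒< : ∀ {m n} → (m <ᵇ n) ≡ true → m < n
<ᵇ-true⇒< {m} {n} = <ᵇ⇒< m n ∘ true⇒T

∧-true : ∀ {a b} → a ≡ true → b ≡ true → a ∧ b ≡ true
∧-true refl refl = refl

∧-trueˡ : ∀ {a b} → a ∧ b ≡ true → a ≡ true
∧-trueˡ {true} _ = refl

∧-trueʳ : ∀ {a b} → a ∧ b ≡ true → b ≡ true
∧-trueʳ {true} p = p

∧-split : ∀ a {b} → a ∧ b ≡ true → a ≡ true × b ≡ true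
∧-split true p = refl , p

-- Pair sums and the two largest weights

_≺_ : ∀ {n} → Fin n → Fin n → Bool
u ≺ v = toℕ u <ᵇ toℕ v

e₂ : ∀ {n} → (Fin n → ℕ) → ℕ
e₂ {n} f = ∑[ u < n ] ∑[ v < n ] (f u * f v * 𝟙 (u ≺ v))

squares : ∀ {n} → (Fin n → ℕ) → ℕ
squares {n} f = ∑[ u < n ] (f u * f u)

trichotomy : ∀ {n} (u v : Fin n) → 𝟙 (u ≺ v) + 𝟙 (v ≺ u) + 𝟙 (v == u) ≡ 1
trichotomy u v with Fin.<-cmp u v
... | tri< u<v u≢v v≮u rewrite <⇒<ᵇ-true u<v | ≢⇒== (u≢v ∘ sym) = cong (λ b → suc (𝟙 b) + 0) (≮⇒false v≮u)
  where
  ≮⇒false : ∀ {m n} → ¬ m < n → (m <ᵇ n) ≡ false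
  ≮⇒false {m} {n} p with m <ᵇ n in eq
  ... | true  = contradiction (<ᵇ-true⇒< eq) p
  ... | false = refl
... | tri≈ u≮u refl _ rewrite ==-refl u with toℕ u <ᵇ toℕ u in eq
...   | true  = contradiction (<ᵇ-true⇒< {toℕ u} eq) u≮u
...   | false = refl
trichotomy u v | tri> u≮v u≢v v<u rewrite <⇒<ᵇ-true v<u | ≢⇒== (u≢v ∘ sym) with toℕ u <ᵇ toℕ v in eq
...   | true  = contradiction (<ᵇ-true⇒< eq) u≮v
...   | false = refl

square-of-sum : ∀ {n} (f : Fin n → ℕ) → 2 * e₂ f + squares f ≡ sum f * sum f
square-of-sum {n} f = begin
  2 * e₂ f + squares f
    ≡⟨ cong (λ s → e₂ f + s + squares f) (+-identityʳ (e₂ f)) ⟩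
  e₂ f + e₂ f + squares f
    ≡⟨ cong (λ s → e₂ f + s + squares f) (∑-comm (λ u v → f u * f v * 𝟙 (u ≺ v))) ⟩
  e₂ f + ∑[ u < n ] ∑[ v < n ] (f v * f u * 𝟙 (v ≺ u)) + squares f
    ≡⟨ cong₂ _+_ (sym (∑-distrib-+ (λ u → ∑[ v < n ] (f u * f v * 𝟙 (u ≺ v))) (λ u → ∑[ v < n ] (f v * f u * 𝟙 (v ≺ u)))))
                 (sum-cong-≗ λ u → sym (∑-δ (λ v → f u * f v) u)) ⟩
  ∑[ u < n ] (∑[ v < n ] (f u * f v * 𝟙 (u ≺ v)) + ∑[ v < n ] (f v * f u * 𝟙 (v ≺ u))) +
    ∑[ u < n ] ∑[ v < n ] (f u * f v * 𝟙 (v == u))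
    ≡⟨ ∑-distrib-+ (λ u → ∑[ v < n ] (f u * f v * 𝟙 (u ≺ v)) + ∑[ v < n ] (f v * f u * 𝟙 (v ≺ u)))
                   (λ u → ∑[ v < n ] (f u * f v * 𝟙 (v == u))) ⟨
  ∑[ u < n ] (∑[ v < n ] (f u * f v * 𝟙 (u ≺ v)) + ∑[ v < n ] (f v * f u * 𝟙 (v ≺ u)) +
    ∑[ v < n ] (f u * f v * 𝟙 (v == u)))
    ≡⟨ sum-cong-≗ row ⟩
  ∑[ u < n ] (f u * sum f)
    ≡⟨ ∑-*ʳ (sum f) f ⟩
  sum f * sum f ∎
  where
  open ≡-Reasoning
  collect : ∀ a b x y z → a * b * x + b * a * y + a * b * z ≡ a * b * (x + y + z)
  collect = solve-∀
  row : ∀ u → ∑[ v < n ] (f u * f v * 𝟙 (u ≺ v)) + ∑[ v < n ] (f v * f u * 𝟙 (v ≺ u)) +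
              ∑[ v < n ] (f u * f v * 𝟙 (v == u)) ≡ f u * sum f
  row u = begin
    ∑[ v < n ] (f u * f v * 𝟙 (u ≺ v)) + ∑[ v < n ] (f v * f u * 𝟙 (v ≺ u)) + ∑[ v < n ] (f u * f v * 𝟙 (v == u))
      ≡⟨ cong (_+ ∑[ v < n ] (f u * f v * 𝟙 (v == u)))
           (∑-distrib-+ (λ v → f u * f v * 𝟙 (u ≺ v)) (λ v → f v * f u * 𝟙 (v ≺ u))) ⟨
    ∑[ v < n ] (f u * f v * 𝟙 (u ≺ v) + f v * f u * 𝟙 (v ≺ u)) + ∑[ v < n ] (f u * f v * 𝟙 (v == u))
      ≡⟨ ∑-distrib-+ (λ v → f u * f v * 𝟙 (u ≺ v) + f v * f u * 𝟙 (v ≺ u)) (λ v → f u * f v * 𝟙 (v == u)) ⟨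
    ∑[ v < n ] (f u * f v * 𝟙 (u ≺ v) + f v * f u * 𝟙 (v ≺ u) + f u * f v * 𝟙 (v == u))
      ≡⟨ sum-cong-≗ (λ v → trans (collect (f u) (f v) (𝟙 (u ≺ v)) (𝟙 (v ≺ u)) (𝟙 (v == u)))
           (trans (cong (f u * f v *_) (trichotomy u v)) (*-identityʳ (f u * f v)))) ⟩
    ∑[ v < n ] (f u * f v)
      ≡⟨ ∑-*ˡ (f u) f ⟩
    f u * sum f ∎

others : ∀ {n} → Fin n → Fin n → Fin n → Bool
others i j u = not (u == i) ∧ not (u == j)

∑-extract₂ : ∀ {n} (f : Fin n → ℕ) {i j} → i ≢ j →
             sum f ≡ f i + f j + ∑[ u < n ] (f u * 𝟙 (others i j u))
∑-extract₂ {n} f {i} {j} i≢j = begin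
  sum f
    ≡⟨ sum-cong-≗ each ⟩
  ∑[ u < n ] (f u * 𝟙 (u == i) + f u * 𝟙 (u == j) + f u * 𝟙 (others i j u))
    ≡⟨ ∑-distrib-+ (λ u → f u * 𝟙 (u == i) + f u * 𝟙 (u == j)) (λ u → f u * 𝟙 (others i j u)) ⟩
  ∑[ u < n ] (f u * 𝟙 (u == i) + f u * 𝟙 (u == j)) + rest
    ≡⟨ cong (_+ rest) (trans (∑-distrib-+ (λ u → f u * 𝟙 (u == i)) (λ u → f u * 𝟙 (u == j)))
                             (cong₂ _+_ (∑-δ f i) (∑-δ f j))) ⟩
  f i + f j + rest ∎
  where
  open ≡-Reasoning
  rest : ℕ
  rest = ∑[ u < n ] (f u * 𝟙 (others i j u))
  one : ∀ a → a ≡ a * 1 + a * 0 + a * 0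
  one = solve-∀
  two : ∀ a → a ≡ a * 0 + a * 1 + a * 0
  two = solve-∀
  three : ∀ a → a ≡ a * 0 + a * 0 + a * 1
  three = solve-∀
  each : ∀ u → f u ≡ f u * 𝟙 (u == i) + f u * 𝟙 (u == j) + f u * 𝟙 (others i j u)
  each u with u Fin.≟ i | u Fin.≟ j
  ... | yes refl | yes refl = contradiction refl i≢j
  ... | yes refl | no _     = one (f u)
  ... | no _     | yes refl = two (f u)
  ... | no _     | no _     = three (f u)

argmax : ∀ {n} (f : Fin (suc n) → ℕ) → ∃ λ i → ∀ u → f u ≤ f i
argmax {zero}  f = zero , λ { zero → ≤-refl }
argmax {suc n} f with i , max ← argmax (f ∘ suc) | ≤-total (f zero) (f (suc i))
... | inj₁ p = suc i , λ { zero → p ; (suc u) → max u }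
... | inj₂ p = zero , λ { zero → ≤-refl ; (suc u) → ≤-trans (max u) p }

-- Of the two largest weights only the bound on products of distinct weights is recorded; this is
-- what lets two of the three factors of a weighted triple be replaced by one common product.
largest-two : ∀ {n} (f : Fin (2 + n) → ℕ) →
  ∃ λ i → ∃ λ j → i ≢ j × (∀ u v → u ≢ v → f u * f v ≤ f i * f j)
largest-two f with i , maxᵢ ← argmax f with j′ , maxⱼ ← argmax (f ∘ punchIn i) =
  i , punchIn i j′ , Fin.punchInᵢ≢i i j′ ∘ sym , product
  where
  below : ∀ u → u ≢ i → f u ≤ f (punchIn i j′)
  below u u≢i = subst (λ x → f x ≤ f (punchIn i j′)) (Fin.punchIn-punchOut (u≢i ∘ sym)) (maxⱼ _)
  product : ∀ u v → u ≢ v → f u * f v ≤ f i * f (punchIn i j′)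
  product u v u≢v with u Fin.≟ i
  ... | yes refl = *-monoʳ-≤ (f i) (below v (u≢v ∘ sym))
  ... | no u≢i   = ≤-trans (≤-reflexive (*-comm (f u) (f v))) (*-mono-≤ (maxᵢ v) (below u u≢i))

-- The layer-cake bound for sparse triples

layer-cake : ∀ k m → m ≤ k → ∑[ τ < k ] 𝟙 (toℕ τ <ᵇ m) ≡ m
layer-cake k       zero    _         = ∑-zero {k} λ _ → refl
layer-cake (suc k) (suc m) (s≤s m≤k) = cong suc (layer-cake k m m≤k)

member : ∀ {n s} → Vec (Fin n) s → Fin n → Bool
member []      u = false
member (x ∷ v) u = (x == u) ∨ member v u

member₃ : ∀ {n s} → Vec (Fin n) s → Relation₃ n
member₃ v x y z = member v x ∧ (member v y ∧ member v z)

-- The length is the counting sum itself, so `Sparse` can be applied with s equal to that sum and no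
-- transport. The map `g` collects the shifts by `suc` in the recursion.
enumerate : ∀ {n N} (p : Fin n → Bool) → (Fin n → Fin N) → Vec (Fin N) (∑[ u < n ] 𝟙 (p u))
enumerate {zero}  p g = []
enumerate {suc n} p g with p zero
... | true  = g zero ∷ enumerate (p ∘ suc) (g ∘ suc)
... | false = enumerate (p ∘ suc) (g ∘ suc)

∨-trueʳ : ∀ a {b} → b ≡ true → a ∨ b ≡ true
∨-trueʳ true  _ = refl
∨-trueʳ false p = p

enumerate-member : ∀ {n N} (p : Fin n → Bool) (g : Fin n → Fin N) u →
                   p u ≡ true → member (enumerate p g) (g u) ≡ true
enumerate-member {suc n} p g zero pu with p zero
enumerate-member {suc n} p g zero refl | true rewrite ==-refl (g zero) = refl
enumerate-member {suc n} p g (suc u) pu with p zero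
... | true  = ∨-trueʳ (g zero == g (suc u)) (enumerate-member (p ∘ suc) (g ∘ suc) u pu)
... | false = enumerate-member (p ∘ suc) (g ∘ suc) u pu

-- Entries of the vector may repeat, so that sets of fewer than 2 + s labels are included and the
-- deletion argument can run over all vectors without tracking distinctness.
Sparse : ∀ {n} → ℕ → Relation₃ n → Set
Sparse {n} k M = ∀ s → s ≤ k → (v : Vec (Fin n) (2 + s)) →
  # (λ x y z → M x y z ∧ member₃ v x y z) ≤ s

weighted-# : ∀ {n} → Relation₃ n → (Fin n → ℕ) → ℕ
weighted-# M f = Σ³ λ x y z → f x * (f y * f z) * 𝟙 (M x y z)

above : ∀ {n} → (Fin n → ℕ) → ℕ → Relation₃ n
above f τ x y z = (τ <ᵇ f x) ∧ ((τ <ᵇ f y) ∧ (τ <ᵇ f z))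

-- The minimum of x, y, z and k, written as a sum over thresholds so that it can be exchanged with
-- the sum over triples.
layers : ℕ → ℕ → ℕ → ℕ → ℕ
layers k x y z = ∑[ τ < k ] 𝟙 ((toℕ τ <ᵇ x) ∧ ((toℕ τ <ᵇ y) ∧ (toℕ τ <ᵇ z)))

≤layers : ∀ {k m x y z} → m ≤ k → m ≤ x → m ≤ y → m ≤ z → m ≤ layers k x y z
≤layers {k} {m} m≤k m≤x m≤y m≤z = ≤-trans (≤-reflexive (sym (layer-cake k m m≤k)))
  (∑-mono {k} λ τ → 𝟙-mono λ q → let τ<m = <ᵇ-true⇒< {toℕ τ} q in
    ∧-true (<⇒<ᵇ-true (<-≤-trans τ<m m≤x))
      (∧-true (<⇒<ᵇ-true (<-≤-trans τ<m m≤y)) (<⇒<ᵇ-true (<-≤-trans τ<m m≤z))))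

-- The product of three numbers is their minimum times the product of the other two.
product≤layers : ∀ k p {x y z} → x ≤ k → y ≤ k → z ≤ k → x * y ≤ p → x * z ≤ p → y * z ≤ p →
  x * (y * z) ≤ p * layers k x y z
product≤layers k p {x} {y} {z} x≤k y≤k z≤k xy xz yz with ≤-total x y | ≤-total x z | ≤-total y z
... | inj₁ x≤y | inj₁ x≤z | _ = ≤-trans (≤-reflexive (*-comm x (y * z)))
  (*-mono-≤ yz (≤layers x≤k ≤-refl x≤y x≤z))
... | inj₁ x≤y | inj₂ z≤x | _ = ≤-trans (≤-reflexive (sym (*-assoc x y z)))
  (*-mono-≤ xy (≤layers z≤k z≤x (≤-trans z≤x x≤y) ≤-refl))
... | inj₂ y≤x | _ | inj₁ y≤z = ≤-trans (≤-reflexive (rotate x y z))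
  (*-mono-≤ xz (≤layers y≤k y≤x ≤-refl y≤z))
  where
  rotate : ∀ x y z → x * (y * z) ≡ x * z * y
  rotate = solve-∀
... | inj₂ y≤x | _ | inj₂ z≤y = ≤-trans (≤-reflexive (sym (*-assoc x y z)))
  (*-mono-≤ xy (≤layers z≤k (≤-trans z≤y y≤x) z≤y ≤-refl))

-- The s vertices of weight above τ other than i and j, together with i and j, span at most
-- s triples of M; integrate this over τ.
weighted-#-bound : ∀ {n k} (M : Relation₃ n) → IsIncreasing M → Sparse k M →
  (f : Fin n → ℕ) → sum f ≤ k → ∀ {i j} → (∀ u v → u ≢ v → f u * f v ≤ f i * f j) →
  weighted-# M f ≤ f i * f j * ∑[ u < n ] (f u * 𝟙 (others i j u))
weighted-#-bound {n} {k} M inc sparse f total {i} {j} large = begin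
  weighted-# M f
    ≤⟨ Σ³-mono each ⟩
  Σ³ (λ x y z → p * ∑[ τ < k ] 𝟙 (M x y z ∧ above f (toℕ τ) x y z))
    ≡⟨ Σ³-*ˡ p (λ x y z → ∑[ τ < k ] 𝟙 (M x y z ∧ above f (toℕ τ) x y z)) ⟩
  p * Σ³ (λ x y z → ∑[ τ < k ] 𝟙 (M x y z ∧ above f (toℕ τ) x y z))
    ≡⟨ cong (p *_) (∑-Σ³-comm (λ (τ : Fin k) x y z → 𝟙 (M x y z ∧ above f (toℕ τ) x y z))) ⟨
  p * ∑[ τ < k ] # (λ x y z → M x y z ∧ above f (toℕ τ) x y z)
    ≤⟨ *-monoʳ-≤ p (∑-mono {k} λ τ → layer (toℕ τ)) ⟩
  p * ∑[ τ < k ] ∑[ u < n ] 𝟙 ((toℕ τ <ᵇ f u) ∧ others i j u)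
    ≡⟨ cong (p *_) (∑-comm (λ (τ : Fin k) u → 𝟙 ((toℕ τ <ᵇ f u) ∧ others i j u))) ⟩
  p * ∑[ u < n ] ∑[ τ < k ] 𝟙 ((toℕ τ <ᵇ f u) ∧ others i j u)
    ≡⟨ cong (p *_) (sum-cong-≗ column) ⟩
  p * ∑[ u < n ] (f u * 𝟙 (others i j u)) ∎
  where
  open ≤-Reasoning
  p : ℕ
  p = f i * f j
  bounded : ∀ u → f u ≤ k
  bounded u = ≤-trans (term≤∑ f u) total
  column : ∀ u → ∑[ τ < k ] 𝟙 ((toℕ τ <ᵇ f u) ∧ others i j u) ≡ f u * 𝟙 (others i j u)
  column u = trans (sum-cong-≗ {k} λ τ → 𝟙-∧ (toℕ τ <ᵇ f u) (others i j u))
    (trans (∑-*ʳ {k} (𝟙 (others i j u)) (λ τ → 𝟙 (toℕ τ <ᵇ f u)))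
      (cong (_* 𝟙 (others i j u)) (layer-cake k (f u) (bounded u))))
  each : ∀ x y z → f x * (f y * f z) * 𝟙 (M x y z) ≤ p * ∑[ τ < k ] 𝟙 (M x y z ∧ above f (toℕ τ) x y z)
  each x y z with M x y z in eq
  ... | false = ≤-trans (≤-reflexive (*-zeroʳ (f x * (f y * f z)))) z≤n
  ... | true with x<y , y<z ← inc x y z eq = ≤-trans (≤-reflexive (*-identityʳ _))
    (product≤layers k p (bounded x) (bounded y) (bounded z)
      (large x y (Fin.<⇒≢ x<y)) (large x z (Fin.<⇒≢ (<-trans x<y y<z))) (large y z (Fin.<⇒≢ y<z)))
  layer : ∀ τ → # (λ x y z → M x y z ∧ above f τ x y z) ≤ ∑[ u < n ] 𝟙 ((τ <ᵇ f u) ∧ others i j u)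
  layer τ = ≤-trans (Σ³-mono λ x y z → 𝟙-mono (within x y z)) (sparse _ small v)
    where
    chosen : Fin n → Bool
    chosen u = (τ <ᵇ f u) ∧ others i j u
    v : Vec (Fin n) (2 + ∑[ u < n ] 𝟙 (chosen u))
    v = i ∷ j ∷ enumerate chosen id
    -- Sparsity is available only for s ≤ k. Every chosen label has weight at least 1, and the total
    -- weight is at most k.
    small : ∑[ u < n ] 𝟙 (chosen u) ≤ k
    small = ≤-trans (∑-mono λ u → positive u) total
      where
      positive : ∀ u → 𝟙 (chosen u) ≤ f u
      positive u with f u
      ... | zero  = z≤n
      ... | suc _ = ≤-trans (𝟙≤1 _) (s≤s z≤n)
    inside : ∀ u → (τ <ᵇ f u) ≡ true → member v u ≡ true
    inside u τ<fu with i Fin.≟ u | j Fin.≟ u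
    ... | yes _  | _      = refl
    ... | no _   | yes _  = refl
    ... | no i≢u | no j≢u = enumerate-member chosen id u
      (∧-true τ<fu (∧-true (cong not (≢⇒== (i≢u ∘ sym))) (cong not (≢⇒== (j≢u ∘ sym)))))

    within : ∀ x y z → M x y z ∧ above f τ x y z ≡ true → M x y z ∧ member₃ v x y z ≡ true
    within x y z q = ∧-true {M x y z} (∧-trueˡ q) (∧-true (inside x (∧-trueˡ r))
      (∧-true (inside y (∧-trueˡ r′)) (inside z (∧-trueʳ {τ <ᵇ f y} r′))))
      where
      r  = ∧-trueʳ {M x y z} q
      r′ = ∧-trueʳ {τ <ᵇ f x} r

-- x and y are the two largest weights in A, r is the rest of A; p, q and h count pairs inside A,
-- pairs inside B and sparse triples, t is the number of edges. While r ≤ b + c the sparse triples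
-- are paid for by the missing pairs 2p = a² − σ; beyond that, by the imbalance of the parts.
local-bound : ∀ {t p q h σ a b c x y} r →
  t ≡ p * b + a * q + p * c + a * b * c + q * c + h →
  2 * p + σ ≡ a * a → 2 * q ≤ b * b → a ≡ x + y + r → 2 * (x * y) ≤ σ → h ≤ x * y * r →
  486 * t ≤ 64 * (a + b + c) ³
local-bound {t} {p} {q} {h} {σ} {a} {b} {c} {x} {y} r refl pairsA pairsB a-split 2xy≤σ h≤ =
  -- Adding the pairs of equal labels in A back to both sides completes the edge count to the full
  -- polynomial Ψ; the corresponding loss inside B is given away through `pairsB`.
  +-cancelʳ-≤ (243 * (σ * (b + c))) _ _ (begin
    486 * t + 243 * (σ * (b + c))
      ≡⟨ expand p q a b c σ h ⟩
    243 * (2 * p + σ) * (b + c) + 243 * (a + c) * (2 * q) + 486 * (a * b * c) + 486 * h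
      ≤⟨ +-monoˡ-≤ (486 * h) (+-monoˡ-≤ (486 * (a * b * c)) (+-mono-≤
           (*-monoˡ-≤ (b + c) (*-monoʳ-≤ 243 (≤-reflexive pairsA)))
           (*-monoʳ-≤ (243 * (a + c)) pairsB))) ⟩
    243 * (a * a) * (b + c) + 243 * (a + c) * (b * b) + 486 * (a * b * c) + 486 * h
      ≡⟨ collect a b c h ⟩
    243 * Ψ a b c + 486 * h
      ≤⟨ excess (≤-total r (b + c)) ⟩
    64 * (a + b + c) ³ + 243 * (σ * (b + c)) ∎)
  where
  open ≤-Reasoning
  expand : ∀ p q a b c σ h →
    486 * (p * b + a * q + p * c + a * b * c + q * c + h) + 243 * (σ * (b + c)) ≡
    243 * (2 * p + σ) * (b + c) + 243 * (a + c) * (2 * q) + 486 * (a * b * c) + 486 * h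
  expand = solve-∀
  collect : ∀ a b c h →
    243 * (a * a) * (b + c) + 243 * (a + c) * (b * b) + 486 * (a * b * c) + 486 * h ≡
    243 * (a * a * b + a * (b * b) + a * a * c + 2 * (a * b * c) + b * b * c) + 486 * h
  collect = solve-∀
  paid : ∀ g → 486 * (x * y * g) ≤ 243 * (σ * g)
  paid g = begin
    486 * (x * y * g)         ≡⟨ eq x y g ⟩
    243 * (2 * (x * y) * g)   ≤⟨ *-monoʳ-≤ 243 (*-monoˡ-≤ g 2xy≤σ) ⟩
    243 * (σ * g)             ∎
    where
    eq : ∀ x y g → 486 * (x * y * g) ≡ 243 * (2 * (x * y) * g)
    eq = solve-∀
  excess : r ≤ b + c ⊎ b + c ≤ r →
    243 * Ψ a b c + 486 * h ≤ 64 * (a + b + c) ³ + 243 * (σ * (b + c))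
  excess (inj₁ r≤) = +-mono-≤ (Ψ-bound a b c) (begin
    486 * h                       ≤⟨ *-monoʳ-≤ 486 (≤-trans h≤ (*-monoʳ-≤ (x * y) r≤)) ⟩
    486 * (x * y * (b + c))       ≤⟨ paid (b + c) ⟩
    243 * (σ * (b + c))           ∎)
  -- Here r = b + c + d. The part xy(b + c) of the gain is paid for as before. For the rest, A
  -- exceeds B and C by x + y + d, so the parts miss the optimum by 64(x + y + d)³, which is at
  -- least 486xyd.
  excess (inj₂ ≤r) with d , d-eq ← m≤n⇒∃[o]m+o≡n ≤r = begin
    243 * Ψ a b c + 486 * h
      ≤⟨ +-monoʳ-≤ (243 * Ψ a b c) (*-monoʳ-≤ 486 (≤-trans h≤ (≤-reflexive (cong (x * y *_) (sym d-eq))))) ⟩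
    243 * Ψ a b c + 486 * (x * y * (b + c + d))
      ≡⟨ spread (243 * Ψ a b c) x y (b + c) d ⟩
    243 * Ψ a b c + 486 * (x * y * d) + 486 * (x * y * (b + c))
      ≤⟨ +-mono-≤ (+-monoʳ-≤ (243 * Ψ a b c) gain) (paid (b + c)) ⟩
    243 * Ψ a b c + 64 * (x + y + d) ³ + 243 * (σ * (b + c))
      ≤⟨ +-monoˡ-≤ (243 * (σ * (b + c)))
           (subst (λ a → 243 * Ψ a b c + 64 * (x + y + d) ³ ≤ 64 * (a + b + c) ³) (sym a≡)
             (Ψ-excess-bound b c (x + y + d))) ⟩
    64 * (a + b + c) ³ + 243 * (σ * (b + c)) ∎
    where
    spread : ∀ p x y g d → p + 486 * (x * y * (g + d)) ≡ p + 486 * (x * y * d) + 486 * (x * y * g)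
    spread = solve-∀
    regroup : ∀ x y g d → x + y + (g + d) ≡ g + (x + y + d)
    regroup = solve-∀
    a≡ : a ≡ b + c + (x + y + d)
    a≡ = trans a-split (trans (cong (x + y +_) (sym d-eq)) (regroup x y (b + c) d))
    gain : 486 * (x * y * d) ≤ 64 * (x + y + d) ³
    gain = begin
      486 * (x * y * d)         ≤⟨ *-monoˡ-≤ (x * y * d) {486} {768} (≤ᵇ⇒≤ 486 768 _) ⟩
      768 * (x * y * d)         ≡⟨ *-assoc 64 12 (x * y * d) ⟩
      64 * (12 * (x * y * d))   ≤⟨ *-monoʳ-≤ 64 (12xyz≤[x+y+z]³ x y d) ⟩
      64 * (x + y + d) ³        ∎

-- The number of edges of the pattern blown up with part sizes f, g and c.
pattern-# : ∀ {n m} → Relation₃ n → (Fin n → ℕ) → (Fin m → ℕ) → ℕ → ℕ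
pattern-# M f g c =
  e₂ f * sum g + sum f * e₂ g + e₂ f * c + sum f * sum g * c + e₂ g * c + weighted-# M f

pattern-#-bound : ∀ {n m k} (M : Relation₃ n) → IsIncreasing M → Sparse k M →
  ∀ (f : Fin n → ℕ) (g : Fin m → ℕ) c → sum f ≤ k →
  (∃ λ i → ∃ λ j → i ≢ j × (∀ u v → u ≢ v → f u * f v ≤ f i * f j)) →
  486 * pattern-# M f g c ≤ 64 * (sum f + sum g + c) ³
pattern-#-bound {n} M inc sparse f g c total (i , j , i≢j , large) =
  local-bound {pattern-# M f g c} {e₂ f} {e₂ g} {weighted-# M f} {squares f} {sum f} {sum g} {c} {f i} {f j}
    rest refl (square-of-sum f) pairsB (∑-extract₂ f i≢j) 2xy≤σ
    (weighted-#-bound M inc sparse f total {i} {j} large)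
  where
  rest : ℕ
  rest = ∑[ u < n ] (f u * 𝟙 (others i j u))
  pairsB : 2 * e₂ g ≤ sum g * sum g
  pairsB = m+n≤o⇒m≤o (2 * e₂ g) (≤-reflexive (square-of-sum g))
  2xy≤σ : 2 * (f i * f j) ≤ squares f
  2xy≤σ = ≤-trans (am-gm (f i) (f j))
    (m+n≤o⇒m≤o (f i * f i + f j * f j) (≤-reflexive (sym (∑-extract₂ (λ u → f u * f u) i≢j))))

-- Sparse triple systems by the deletion method

-- An unnormalised expectation: the sum of g over all subsets U of Fin R, weighted by p^|U| q^(R - |U|).
𝔼 : ℕ → ℕ → ∀ R → ((Fin R → Bool) → ℕ) → ℕ
𝔼 p q zero    g = g λ ()
𝔼 p q (suc R) g =
  p * 𝔼 p q R (λ U → g (true Vector.∷ U)) + q * 𝔼 p q R (λ U → g (false Vector.∷ U))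

module _ (p q : ℕ) where

  average-attained : ∀ R g → ∃ λ U → (p + q) ^ R * g U ≤ 𝔼 p q R g
  average-attained zero    g = (λ ()) , ≤-reflexive (+-identityʳ _)
  average-attained (suc R) g
    with U , hU ← average-attained R (λ U → g (true Vector.∷ U))
       | V , hV ← average-attained R (λ U → g (false Vector.∷ U))
    with ≤-total (g (true Vector.∷ U)) (g (false Vector.∷ V))
  ... | inj₁ le = true Vector.∷ U , (begin
      (p + q) * (p + q) ^ R * g (true Vector.∷ U)
        ≡⟨ distribute p q ((p + q) ^ R) (g (true Vector.∷ U)) ⟩
      p * ((p + q) ^ R * g (true Vector.∷ U)) + q * ((p + q) ^ R * g (true Vector.∷ U))
        ≤⟨ +-mono-≤ (*-monoʳ-≤ p hU) (*-monoʳ-≤ q (≤-trans (*-monoʳ-≤ ((p + q) ^ R) le) hV)) ⟩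
      𝔼 p q (suc R) g ∎)
    where
    open ≤-Reasoning
    distribute : ∀ p q r g → (p + q) * r * g ≡ p * (r * g) + q * (r * g)
    distribute = solve-∀
  ... | inj₂ le = false Vector.∷ V , (begin
      (p + q) * (p + q) ^ R * g (false Vector.∷ V)
        ≡⟨ distribute p q ((p + q) ^ R) (g (false Vector.∷ V)) ⟩
      p * ((p + q) ^ R * g (false Vector.∷ V)) + q * ((p + q) ^ R * g (false Vector.∷ V))
        ≤⟨ +-mono-≤ (*-monoʳ-≤ p (≤-trans (*-monoʳ-≤ ((p + q) ^ R) le) hU)) (*-monoʳ-≤ q hV) ⟩
      𝔼 p q (suc R) g ∎)
    where
    open ≤-Reasoning
    distribute : ∀ p q r g → (p + q) * r * g ≡ p * (r * g) + q * (r * g)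
    distribute = solve-∀

  𝔼-mono : ∀ R {f g : (Fin R → Bool) → ℕ} → (∀ U → f U ≤ g U) → 𝔼 p q R f ≤ 𝔼 p q R g
  𝔼-mono zero    h = h _
  𝔼-mono (suc R) h = +-mono-≤ (*-monoʳ-≤ p (𝔼-mono R λ U → h (true Vector.∷ U)))
                              (*-monoʳ-≤ q (𝔼-mono R λ U → h (false Vector.∷ U)))

  𝔼-+ : ∀ R (f g : (Fin R → Bool) → ℕ) → 𝔼 p q R (λ U → f U + g U) ≡ 𝔼 p q R f + 𝔼 p q R g
  𝔼-+ zero    f g = refl
  𝔼-+ (suc R) f g = trans
    (cong₂ (λ a b → p * a + q * b)
      (𝔼-+ R (λ U → f (true Vector.∷ U)) (λ U → g (true Vector.∷ U)))
      (𝔼-+ R (λ U → f (false Vector.∷ U)) (λ U → g (false Vector.∷ U))))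
    (interchange p q _ _ _ _)
    where
    interchange : ∀ p q a b c d → p * (a + b) + q * (c + d) ≡ p * a + q * c + (p * b + q * d)
    interchange = solve-∀

  𝔼-* : ∀ R c (g : (Fin R → Bool) → ℕ) → 𝔼 p q R (λ U → c * g U) ≡ c * 𝔼 p q R g
  𝔼-* zero    c g = refl
  𝔼-* (suc R) c g = trans
    (cong₂ (λ a b → p * a + q * b)
      (𝔼-* R c (λ U → g (true Vector.∷ U))) (𝔼-* R c (λ U → g (false Vector.∷ U))))
    (factor p q c _ _)
    where
    factor : ∀ p q c a b → p * (c * a) + q * (c * b) ≡ c * (p * a + q * b)
    factor = solve-∀

  𝔼-const : ∀ R c → 𝔼 p q R (λ _ → c) ≡ (p + q) ^ R * c
  𝔼-const zero    c = sym (+-identityʳ c)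
  𝔼-const (suc R) c = trans (cong (λ a → p * a + q * a) (𝔼-const R c)) (factor p q ((p + q) ^ R) c)
    where
    factor : ∀ p q r c → p * (r * c) + q * (r * c) ≡ (p + q) * r * c
    factor = solve-∀

  𝔼-∑ : ∀ R {n} (g : Fin n → (Fin R → Bool) → ℕ) → 𝔼 p q R (λ U → ∑[ i < n ] g i U) ≡ ∑[ i < n ] 𝔼 p q R (g i)
  𝔼-∑ R {zero}  g = trans (𝔼-const R 0) (*-zeroʳ ((p + q) ^ R))
  𝔼-∑ R {suc n} g = trans (𝔼-+ R (g zero) (λ U → ∑[ i < n ] g (suc i) U))
                          (cong (𝔼 p q R (g zero) +_) (𝔼-∑ R (g ∘ suc)))

  𝔼-missing : ∀ R (c : Fin R → Bool) →
    𝔼 p q R (λ U → ∑[ i < R ] 𝟙 (c i ∧ not (U i))) * (p + q) ≡ (p + q) ^ R * (q * ∑[ i < R ] 𝟙 (c i))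
  𝔼-missing zero    c = sym (trans (+-identityʳ (q * 0)) (*-zeroʳ q))
  𝔼-missing (suc R) c with c zero
  ... | true  = trans (cong (_* (p + q)) (cong (p * X +_) (cong (q *_) first)))
      (trans (expand p q ((p + q) ^ R) X)
        (trans (cong (λ t → (p + q) * t + q * (p + q) * (p + q) ^ R) (𝔼-missing R (c ∘ suc)))
          (collect p q ((p + q) ^ R) (∑[ i < R ] 𝟙 (c (suc i))))))
    where
    X : ℕ
    X = 𝔼 p q R (λ U → ∑[ i < R ] 𝟙 (c (suc i) ∧ not (U i)))
    first : 𝔼 p q R (λ U → 1 + ∑[ i < R ] 𝟙 (c (suc i) ∧ not (U i))) ≡ (p + q) ^ R + X
    first = trans (𝔼-+ R (λ _ → 1) (λ U → ∑[ i < R ] 𝟙 (c (suc i) ∧ not (U i))))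
                  (cong (_+ X) (trans (𝔼-const R 1) (*-identityʳ _)))
    expand : ∀ p q r x → (p * x + q * (r + x)) * (p + q) ≡ (p + q) * (x * (p + q)) + q * (p + q) * r
    expand = solve-∀
    collect : ∀ p q r c → (p + q) * (r * (q * c)) + q * (p + q) * r ≡ (p + q) * r * (q * (1 + c))
    collect = solve-∀
  ... | false = trans (expand p q X)
      (trans (cong ((p + q) *_) (𝔼-missing R (c ∘ suc)))
        (sym (*-assoc (p + q) ((p + q) ^ R) _)))
    where
    X : ℕ
    X = 𝔼 p q R (λ U → ∑[ i < R ] 𝟙 (c (suc i) ∧ not (U i)))
    expand : ∀ p q x → (p * x + q * x) * (p + q) ≡ (p + q) * (x * (p + q))
    expand = solve-∀

  hits : ∀ {R} → (Fin R → Bool) → (Fin R → Bool) → ℕ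
  hits {R} c U = ∑[ i < R ] 𝟙 (c i ∧ U i)

  -- With m = p + q, an index of c contributes the normalised factor (pm + q)/m ≤ 1 + p. The base m
  -- is the largest order of growth for which this moment stays bounded independently of m.
  𝔼-exponential : ∀ R (c : Fin R → Bool) →
    𝔼 p q R (λ U → (p + q) ^ hits c U) ≤ (p + q) ^ R * (1 + p) ^ ∑[ i < R ] 𝟙 (c i)
  𝔼-exponential zero    c = ≤-refl
  𝔼-exponential (suc R) c with c zero
  ... | true  = begin
      p * 𝔼 p q R (λ U → (p + q) * (p + q) ^ hits (c ∘ suc) U) + q * X
        ≡⟨ cong (λ t → p * t + q * X) (𝔼-* R (p + q) (λ U → (p + q) ^ hits (c ∘ suc) U)) ⟩
      p * ((p + q) * X) + q * X
        ≤⟨ m≤m+n _ (p * X) ⟩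
      p * ((p + q) * X) + q * X + p * X
        ≡⟨ collect p q X ⟩
      (p + q) * ((1 + p) * X)
        ≤⟨ *-monoʳ-≤ (p + q) (*-monoʳ-≤ (1 + p) (𝔼-exponential R (c ∘ suc))) ⟩
      (p + q) * ((1 + p) * ((p + q) ^ R * (1 + p) ^ ∑[ i < R ] 𝟙 (c (suc i))))
        ≡⟨ reorder (p + q) (1 + p) ((p + q) ^ R) _ ⟩
      (p + q) * (p + q) ^ R * ((1 + p) * (1 + p) ^ ∑[ i < R ] 𝟙 (c (suc i))) ∎
    where
    open ≤-Reasoning
    X : ℕ
    X = 𝔼 p q R (λ U → (p + q) ^ hits (c ∘ suc) U)
    collect : ∀ p q x → p * ((p + q) * x) + q * x + p * x ≡ (p + q) * ((1 + p) * x)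
    collect = solve-∀
    reorder : ∀ a b c d → a * (b * (c * d)) ≡ a * c * (b * d)
    reorder = solve-∀
  ... | false = begin
      p * X + q * X
        ≡⟨ *-distribʳ-+ X p q ⟨
      (p + q) * X
        ≤⟨ *-monoʳ-≤ (p + q) (𝔼-exponential R (c ∘ suc)) ⟩
      (p + q) * ((p + q) ^ R * (1 + p) ^ ∑[ i < R ] 𝟙 (c (suc i)))
        ≡⟨ *-assoc (p + q) ((p + q) ^ R) _ ⟨
      (p + q) * (p + q) ^ R * (1 + p) ^ ∑[ i < R ] 𝟙 (c (suc i)) ∎
    where
    open ≤-Reasoning
    X : ℕ
    X = 𝔼 p q R (λ U → (p + q) ^ hits (c ∘ suc) U)

  -- Markov's inequality for the exponential moment: more than s hits have probability at most
  -- m^-(s+1) times a constant. This has the order of a union bound over all choices of s + 1 hits,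
  -- without enumerating subsets.
  𝔼-tail : .{{_ : NonZero (p + q)}} → ∀ R (c : Fin R → Bool) s →
    𝔼 p q R (λ U → 𝟙 (s <ᵇ hits c U)) * (p + q) ^ suc s ≤ (p + q) ^ R * (1 + p) ^ ∑[ i < R ] 𝟙 (c i)
  𝔼-tail R c s = begin
    𝔼 p q R (λ U → 𝟙 (s <ᵇ hits c U)) * (p + q) ^ suc s
      ≡⟨ trans (*-comm _ ((p + q) ^ suc s)) (sym (𝔼-* R ((p + q) ^ suc s) (λ U → 𝟙 (s <ᵇ hits c U)))) ⟩
    𝔼 p q R (λ U → (p + q) ^ suc s * 𝟙 (s <ᵇ hits c U))
      ≤⟨ 𝔼-mono R pointwise ⟩
    𝔼 p q R (λ U → (p + q) ^ hits c U)
      ≤⟨ 𝔼-exponential R c ⟩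
    (p + q) ^ R * (1 + p) ^ ∑[ i < R ] 𝟙 (c i) ∎
    where
    open ≤-Reasoning
    pointwise : ∀ U → (p + q) ^ suc s * 𝟙 (s <ᵇ hits c U) ≤ (p + q) ^ hits c U
    pointwise U with s <ᵇ hits c U in eq
    ... | true  = ≤-trans (≤-reflexive (*-identityʳ _)) (^-monoʳ-≤ (p + q) (<ᵇ-true⇒< {s} {hits c U} eq))
    ... | false = ≤-trans (≤-reflexive (*-zeroʳ ((p + q) ^ suc s))) z≤n

sumVec : ∀ {n} s → (Vec (Fin n) s → ℕ) → ℕ
sumVec     zero    f = f []
sumVec {n} (suc s) f = ∑[ x < n ] sumVec s (λ v → f (x ∷ v))

sumVec-mono : ∀ {n} s {f g : Vec (Fin n) s → ℕ} → (∀ v → f v ≤ g v) → sumVec s f ≤ sumVec s g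
sumVec-mono zero    h = h []
sumVec-mono (suc s) h = ∑-mono λ x → sumVec-mono s λ v → h (x ∷ v)

sumVec-const : ∀ {n} s c → sumVec {n} s (λ _ → c) ≡ n ^ s * c
sumVec-const     zero    c = sym (+-identityʳ c)
sumVec-const {n} (suc s) c = trans (sum-cong-≗ {n} λ _ → sumVec-const {n} s c)
  (trans (∑-const n (n ^ s * c)) (sym (*-assoc n (n ^ s) c)))

term≤sumVec : ∀ {n} s (f : Vec (Fin n) s → ℕ) v → f v ≤ sumVec s f
term≤sumVec zero    f []      = ≤-refl
term≤sumVec (suc s) f (x ∷ v) = ≤-trans (term≤sumVec s (λ w → f (x ∷ w)) v)
  (term≤∑ (λ y → sumVec s (λ w → f (y ∷ w))) x)

sumVec-*ʳ : ∀ {n} s c (f : Vec (Fin n) s → ℕ) → sumVec s (λ v → f v * c) ≡ sumVec s f * c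
sumVec-*ʳ     zero    c f = refl
sumVec-*ʳ {n} (suc s) c f = trans (sum-cong-≗ λ x → sumVec-*ʳ s c (λ v → f (x ∷ v)))
  (∑-*ʳ c (λ x → sumVec s (λ v → f (x ∷ v))))

∑-sumVec-comm : ∀ {R n} s (f : Fin R → Vec (Fin n) s → ℕ) →
  ∑[ i < R ] sumVec s (f i) ≡ sumVec s (λ v → ∑[ i < R ] f i v)
∑-sumVec-comm         zero    f = refl
∑-sumVec-comm {R} {n} (suc s) f = trans (∑-comm λ i x → sumVec s (λ v → f i (x ∷ v)))
  (sum-cong-≗ λ x → ∑-sumVec-comm s (λ i v → f i (x ∷ v)))

𝔼-sumVec : ∀ p q R {n} s (g : Vec (Fin n) s → (Fin R → Bool) → ℕ) →
  𝔼 p q R (λ U → sumVec s (λ v → g v U)) ≡ sumVec s (λ v → 𝔼 p q R (g v))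
𝔼-sumVec p q R zero    g = refl
𝔼-sumVec p q R (suc s) g = trans (𝔼-∑ p q R (λ x U → sumVec s (λ v → g (x ∷ v) U)))
  (sum-cong-≗ λ x → 𝔼-sumVec p q R s (λ v → g (x ∷ v)))

-- Random triples and the deletion of crowded ones

ascending : ∀ {n} → Relation₃ n
ascending x y z = (x ≺ y) ∧ (y ≺ z)

-- `𝔼` ranges over subsets of some `Fin R`, so ordered triples are coded as indices; those that are
-- not ascending are also sampled and then ignored by `candidate`.
cell : ∀ {n} → Fin n → Fin n → Fin n → Fin (n * (n * n))
cell x y z = combine x (combine y z)

uncell : ∀ {n} {X : Set} → (Fin n → Fin n → Fin n → X) → Fin (n * (n * n)) → X
uncell {n} f i = let x , i′ = remQuot (n * n) i ; y , z = remQuot n i′ in f x y z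

uncell-cell : ∀ {n} {X : Set} (f : Fin n → Fin n → Fin n → X) x y z → uncell {n} f (cell {n} x y z) ≡ f x y z
uncell-cell {n} f x y z = trans
  (cong (λ (x , i) → let y , z = remQuot n i in f x y z) (Fin.remQuot-combine {n} {n * n} x (combine y z)))
  (cong (λ (y , z) → f x y z) (Fin.remQuot-combine {n} {n} y z))

∑-cell : ∀ {n} (f : Fin (n * (n * n)) → ℕ) → sum f ≡ Σ³ λ x y z → f (cell {n} x y z)
∑-cell {n} f = trans (∑-combine n (n * n) f)
  (sum-cong-≗ {n} λ x → ∑-combine n n (λ i → f (combine {n} {n * n} x i)))

member-count : ∀ {n s} (v : Vec (Fin n) s) → ∑[ u < n ] 𝟙 (member v u) ≤ s
member-count {n} []      = ≤-reflexive (∑-zero {n} λ _ → refl)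
member-count {n} (x ∷ v) = begin
  ∑[ u < n ] 𝟙 ((x == u) ∨ member v u)
    ≤⟨ ∑-mono (λ u → ∨≤+ (x == u) (member v u)) ⟩
  ∑[ u < n ] (𝟙 (x == u) + 𝟙 (member v u))
    ≡⟨ ∑-distrib-+ (λ u → 𝟙 (x == u)) (λ u → 𝟙 (member v u)) ⟩
  ∑[ u < n ] 𝟙 (x == u) + ∑[ u < n ] 𝟙 (member v u)
    ≤⟨ +-mono-≤ (≤-reflexive (∑-δ′ x)) (member-count v) ⟩
  _ ∎
  where
  open ≤-Reasoning
  ∨≤+ : ∀ a b → 𝟙 (a ∨ b) ≤ 𝟙 a + 𝟙 b
  ∨≤+ true  b = s≤s z≤n
  ∨≤+ false b = ≤-refl

member₃-count : ∀ {n s} (v : Vec (Fin n) s) → # (member₃ v) ≤ s * (s * s)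
member₃-count v = ≤-trans
  (≤-reflexive (trans
    (Σ³-cong λ x y z → trans (𝟙-∧ (member v x) (member v y ∧ member v z))
                             (cong (𝟙 (member v x) *_) (𝟙-∧ (member v y) (member v z))))
    (Σ³-product (𝟙 ∘ member v) (𝟙 ∘ member v) (𝟙 ∘ member v))))
  (*-mono-≤ (member-count v) (*-mono-≤ (member-count v) (member-count v)))

≮ᵇ⇒≥ : ∀ {m n} → (m <ᵇ n) ≡ false → n ≤ m
≮ᵇ⇒≥ {m} {n} p = ≮⇒≥ λ m<n → case trans (sym p) (<⇒<ᵇ-true m<n) of λ ()

≡ᵇ0 : ∀ {n} → (n ≡ᵇ 0) ≡ true → n ≡ 0
≡ᵇ0 {zero} _ = refl

size : ℕ → ℕ
size s = (2 + s) * ((2 + s) * (2 + s))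

-- Times m = p + q, this bounds the expected number of deletions when n = tm. It does not involve q,
-- hence stays constant while m grows.
crowdingBound : ℕ → ℕ → ℕ → ℕ
crowdingBound l p t = ∑[ s < l ] (size (toℕ s) * (t ^ (2 + toℕ s) * (1 + p) ^ size (toℕ s)))

^-distribʳ-* : ∀ n a b → (a * b) ^ n ≡ a ^ n * b ^ n
^-distribʳ-* zero    a b = refl
^-distribʳ-* (suc n) a b = trans (cong (a * b *_) (^-distribʳ-* n a b)) (interchange a b (a ^ n) (b ^ n))
  where
  interchange : ∀ a b c d → a * b * (c * d) ≡ a * c * (b * d)
  interchange = solve-∀

module Deletion (l n p q : ℕ) .{{_ : NonZero (p + q)}} where

  R : ℕ
  R = n * (n * n)

  Cells : Set
  Cells = Fin R → Bool

  candidate : Cells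
  candidate = uncell {n} ascending

  inside : ∀ {s} → Vec (Fin n) s → Cells
  inside v i = candidate i ∧ uncell {n} (member₃ v) i

  inside-count : ∀ s (v : Vec (Fin n) (2 + s)) → ∑[ i < R ] 𝟙 (inside v i) ≤ size s
  inside-count s v = begin
    ∑[ i < R ] 𝟙 (inside v i)
      ≤⟨ ∑-mono {R} (λ i → 𝟙-mono (∧-trueʳ {candidate i})) ⟩
    ∑[ i < R ] 𝟙 (uncell {n} (member₃ v) i)
      ≡⟨ ∑-cell {n} (λ i → 𝟙 (uncell {n} (member₃ v) i)) ⟩
    Σ³ (λ x y z → 𝟙 (uncell {n} (member₃ v) (cell {n} x y z)))
      ≡⟨ Σ³-cong (λ x y z → cong 𝟙 (uncell-cell (member₃ v) x y z)) ⟩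
    # (member₃ v)
      ≤⟨ member₃-count v ⟩
    size s ∎
    where open ≤-Reasoning

  crowded : ∀ s → Vec (Fin n) (2 + s) → Cells → Bool
  crowded s v U = s <ᵇ hits p q (inside v) U

  conflicts : Cells → Fin R → ℕ
  conflicts U i = ∑[ s < l ] sumVec (2 + toℕ s) λ v → 𝟙 (crowded (toℕ s) v U ∧ inside v i)

  kept : Cells → Cells
  kept U i = candidate i ∧ (U i ∧ (conflicts U i ≡ᵇ 0))

  crowds : ℕ → Cells → ℕ
  crowds s U = sumVec (2 + s) λ v → 𝟙 (crowded s v U)

  missing : Cells → ℕ
  missing U = ∑[ i < R ] 𝟙 (candidate i ∧ not (U i))

  -- The random choice is judged by its losses, triples not sampled plus a bound on those deleted,
  -- so that a single value at or below the average suffices.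
  cost : Cells → ℕ
  cost U = missing U + ∑[ s < l ] (size (toℕ s) * crowds (toℕ s) U)

  conflict-count : ∀ U → ∑[ i < R ] conflicts U i ≤ ∑[ s < l ] (size (toℕ s) * crowds (toℕ s) U)
  conflict-count U = ≤-trans
    (≤-reflexive (∑-comm {R} {l} λ i s → sumVec (2 + toℕ s) λ v → 𝟙 (crowded (toℕ s) v U ∧ inside v i)))
    (∑-mono {l} λ s → each (toℕ s))
    where
    open ≤-Reasoning
    each : ∀ s → ∑[ i < R ] sumVec (2 + s) (λ v → 𝟙 (crowded s v U ∧ inside v i)) ≤ size s * crowds s U
    each s = begin
      ∑[ i < R ] sumVec (2 + s) (λ v → 𝟙 (crowded s v U ∧ inside v i))
        ≡⟨ ∑-sumVec-comm {R} (2 + s) (λ i v → 𝟙 (crowded s v U ∧ inside v i)) ⟩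
      sumVec (2 + s) (λ v → ∑[ i < R ] 𝟙 (crowded s v U ∧ inside v i))
        ≤⟨ sumVec-mono (2 + s) (λ v → ≤-trans
             (≤-reflexive (trans (sum-cong-≗ {R} λ i → 𝟙-∧ (crowded s v U) (inside v i))
                                 (∑-*ˡ {R} (𝟙 (crowded s v U)) (λ i → 𝟙 (inside v i)))))
             (*-monoʳ-≤ (𝟙 (crowded s v U)) (inside-count s v))) ⟩
      sumVec (2 + s) (λ v → 𝟙 (crowded s v U) * size s)
        ≡⟨ sumVec-*ʳ (2 + s) (size s) (λ v → 𝟙 (crowded s v U)) ⟩
      crowds s U * size s
        ≡⟨ *-comm (crowds s U) (size s) ⟩
      size s * crowds s U ∎

  candidates≤kept+cost : ∀ U → ∑[ i < R ] 𝟙 (candidate i) ≤ ∑[ i < R ] 𝟙 (kept U i) + cost U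
  candidates≤kept+cost U = begin
    ∑[ i < R ] 𝟙 (candidate i)
      ≤⟨ ∑-mono {R} (λ i → each (candidate i) (U i) (conflicts U i)) ⟩
    ∑[ i < R ] (𝟙 (kept U i) + (𝟙 (candidate i ∧ not (U i)) + conflicts U i))
      ≡⟨ ∑-distrib-+ (λ i → 𝟙 (kept U i)) (λ i → 𝟙 (candidate i ∧ not (U i)) + conflicts U i) ⟩
    ∑[ i < R ] 𝟙 (kept U i) + ∑[ i < R ] (𝟙 (candidate i ∧ not (U i)) + conflicts U i)
      ≡⟨ cong (∑[ i < R ] 𝟙 (kept U i) +_) (∑-distrib-+ (λ i → 𝟙 (candidate i ∧ not (U i))) (conflicts U)) ⟩
    ∑[ i < R ] 𝟙 (kept U i) + (missing U + ∑[ i < R ] conflicts U i)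
      ≤⟨ +-monoʳ-≤ (∑[ i < R ] 𝟙 (kept U i)) (+-monoʳ-≤ (missing U) (conflict-count U)) ⟩
    ∑[ i < R ] 𝟙 (kept U i) + cost U ∎
    where
    open ≤-Reasoning
    each : ∀ a b c → 𝟙 a ≤ 𝟙 (a ∧ (b ∧ (c ≡ᵇ 0))) + (𝟙 (a ∧ not b) + c)
    each false b     c       = z≤n
    each true  false c       = s≤s z≤n
    each true  true  zero    = s≤s z≤n
    each true  true  (suc c) = s≤s z≤n

  kept⇒ : ∀ U i → kept U i ≡ true → candidate i ≡ true × U i ≡ true × conflicts U i ≡ 0
  kept⇒ U i h with c , r ← ∧-split (candidate i) h with u , none ← ∧-split (U i) r = c , u , ≡ᵇ0 none

  -- A crowded vector loses all its triples and not merely the surplus, so it keeps none; any other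
  -- vector spans at most s by the definition of crowded. The generosity costs only the constant
  -- factor `size s`.
  kept-sparse : ∀ U s → s < l → (v : Vec (Fin n) (2 + s)) →
    ∑[ i < R ] 𝟙 (kept U i ∧ uncell {n} (member₃ v) i) ≤ s
  kept-sparse U s s<l v with crowded s v U in eq
  ... | false = ≤-trans (∑-mono {R} λ i → 𝟙-mono (below i)) (≮ᵇ⇒≥ eq)
    where
    below : ∀ i → kept U i ∧ uncell {n} (member₃ v) i ≡ true → inside v i ∧ U i ≡ true
    below i t with l , m ← ∧-split (kept U i) t with c , u , _ ← kept⇒ U i l =
      ∧-true {inside v i} (∧-true {candidate i} c m) u
  ... | true = ≤-trans (≤-reflexive (∑-zero {R} λ i → empty i)) z≤n
    where
    conflict : ∀ i → inside v i ≡ true → 1 ≤ conflicts U i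
    conflict i h = begin
      1
        ≡⟨ cong 𝟙 (∧-true eq h) ⟨
      𝟙 (crowded s v U ∧ inside v i)
        ≤⟨ term≤sumVec (2 + s) (λ w → 𝟙 (crowded s w U ∧ inside w i)) v ⟩
      sumVec (2 + s) (λ w → 𝟙 (crowded s w U ∧ inside w i))
        ≡⟨ cong (λ r → sumVec (2 + r) (λ w → 𝟙 (crowded r w U ∧ inside w i))) (Fin.toℕ-fromℕ< s<l) ⟨
      sumVec (2 + toℕ (Fin.fromℕ< s<l)) (λ w → 𝟙 (crowded (toℕ (Fin.fromℕ< s<l)) w U ∧ inside w i))
        ≤⟨ term≤∑ {l} (λ r → sumVec (2 + toℕ r) (λ w → 𝟙 (crowded (toℕ r) w U ∧ inside w i))) (Fin.fromℕ< s<l) ⟩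
      conflicts U i ∎
      where open ≤-Reasoning
    empty : ∀ i → 𝟙 (kept U i ∧ uncell {n} (member₃ v) i) ≡ 0
    empty i with kept U i ∧ uncell {n} (member₃ v) i in t
    ... | false = refl
    ... | true  with l , m ← ∧-split (kept U i) t with c , _ , none ← kept⇒ U i l =
      contradiction (≤-trans (conflict i (∧-true {candidate i} c m)) (≤-reflexive none)) λ ()

  -- Of the 2 + s factors m in the number n^(2+s) of vectors, the tail bound cancels s + 1. The
  -- single factor left is the same for every s.
  average-crowds : ∀ t → n ≡ t * (p + q) → ∀ s →
    𝔼 p q R (crowds s) ≤ (p + q) ^ R * ((p + q) * (t ^ (2 + s) * (1 + p) ^ size s))
  average-crowds t n≡ s = *-cancelʳ-≤ _ _ (m ^ suc s) {{m^n≢0 m (suc s)}} (begin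
    𝔼 p q R (crowds s) * m ^ suc s
      ≡⟨ cong (_* m ^ suc s) (𝔼-sumVec p q R (2 + s) (λ v U → 𝟙 (crowded s v U))) ⟩
    sumVec (2 + s) (λ v → 𝔼 p q R (λ U → 𝟙 (crowded s v U))) * m ^ suc s
      ≡⟨ sumVec-*ʳ (2 + s) (m ^ suc s) (λ v → 𝔼 p q R (λ U → 𝟙 (crowded s v U))) ⟨
    sumVec (2 + s) (λ v → 𝔼 p q R (λ U → 𝟙 (crowded s v U)) * m ^ suc s)
      ≤⟨ sumVec-mono (2 + s) (λ v → ≤-trans (𝔼-tail p q R (inside v) s)
           (*-monoʳ-≤ (m ^ R) (^-monoʳ-≤ (1 + p) (inside-count s v)))) ⟩
    sumVec {n} (2 + s) (λ _ → m ^ R * (1 + p) ^ size s)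
      ≡⟨ sumVec-const {n} (2 + s) (m ^ R * (1 + p) ^ size s) ⟩
    n ^ (2 + s) * (m ^ R * (1 + p) ^ size s)
      ≡⟨ cong (λ x → x ^ (2 + s) * (m ^ R * (1 + p) ^ size s)) n≡ ⟩
    (t * m) ^ (2 + s) * (m ^ R * (1 + p) ^ size s)
      ≡⟨ cong (_* (m ^ R * (1 + p) ^ size s)) (^-distribʳ-* (2 + s) t m) ⟩
    t ^ (2 + s) * (m * m ^ suc s) * (m ^ R * (1 + p) ^ size s)
      ≡⟨ reorder (t ^ (2 + s)) m (m ^ suc s) (m ^ R) ((1 + p) ^ size s) ⟩
    m ^ R * (m * (t ^ (2 + s) * (1 + p) ^ size s)) * m ^ suc s ∎)
    where
    open ≤-Reasoning
    m : ℕ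
    m = p + q
    reorder : ∀ a b c d e → a * (b * c) * (d * e) ≡ d * (b * (a * e)) * c
    reorder = solve-∀

  average-cost : ∀ t → n ≡ t * (p + q) →
    𝔼 p q R cost * (p + q) ≤ (p + q) ^ R * (q * ∑[ i < R ] 𝟙 (candidate i) + (p + q) * (p + q) * crowdingBound l p t)
  average-cost t n≡ = begin
    𝔼 p q R cost * m
      ≡⟨ cong (_* m) (𝔼-+ p q R missing (λ U → ∑[ s < l ] (size (toℕ s) * crowds (toℕ s) U))) ⟩
    (𝔼 p q R missing + 𝔼 p q R (λ U → ∑[ s < l ] (size (toℕ s) * crowds (toℕ s) U))) * m
      ≤⟨ *-monoˡ-≤ m (+-monoʳ-≤ (𝔼 p q R missing) crowd-part) ⟩
    (𝔼 p q R missing + m ^ R * (m * crowdingBound l p t)) * m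
      ≡⟨ *-distribʳ-+ m (𝔼 p q R missing) _ ⟩
    𝔼 p q R missing * m + m ^ R * (m * crowdingBound l p t) * m
      ≡⟨ cong (_+ m ^ R * (m * crowdingBound l p t) * m) (𝔼-missing p q R candidate) ⟩
    m ^ R * (q * ∑[ i < R ] 𝟙 (candidate i)) + m ^ R * (m * crowdingBound l p t) * m
      ≡⟨ reorder (m ^ R) (q * ∑[ i < R ] 𝟙 (candidate i)) m (crowdingBound l p t) ⟩
    m ^ R * (q * ∑[ i < R ] 𝟙 (candidate i) + m * m * crowdingBound l p t) ∎
    where
    open ≤-Reasoning
    m : ℕ
    m = p + q
    reorder : ∀ r a m c → r * a + r * (m * c) * m ≡ r * (a + m * m * c)
    reorder = solve-∀
    shuffle : ∀ a b c d → a * (b * (c * d)) ≡ b * (c * (a * d))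
    shuffle = solve-∀
    crowd-part : 𝔼 p q R (λ U → ∑[ s < l ] (size (toℕ s) * crowds (toℕ s) U)) ≤ m ^ R * (m * crowdingBound l p t)
    crowd-part = begin
      𝔼 p q R (λ U → ∑[ s < l ] (size (toℕ s) * crowds (toℕ s) U))
        ≡⟨ 𝔼-∑ p q R {l} (λ s U → size (toℕ s) * crowds (toℕ s) U) ⟩
      ∑[ s < l ] 𝔼 p q R (λ U → size (toℕ s) * crowds (toℕ s) U)
        ≤⟨ ∑-mono {l} (λ s → ≤-trans
             (≤-reflexive (𝔼-* p q R (size (toℕ s)) (crowds (toℕ s))))
             (≤-trans (*-monoʳ-≤ (size (toℕ s)) (average-crowds t n≡ (toℕ s)))
               (≤-reflexive (shuffle (size (toℕ s)) (m ^ R) m (t ^ (2 + toℕ s) * (1 + p) ^ size (toℕ s)))))) ⟩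
      ∑[ s < l ] (m ^ R * (m * (size (toℕ s) * (t ^ (2 + toℕ s) * (1 + p) ^ size (toℕ s)))))
        ≡⟨ trans (∑-*ˡ {l} (m ^ R) (λ s → m * (size (toℕ s) * (t ^ (2 + toℕ s) * (1 + p) ^ size (toℕ s)))))
             (cong (m ^ R *_) (∑-*ˡ {l} m (λ s → size (toℕ s) * (t ^ (2 + toℕ s) * (1 + p) ^ size (toℕ s))))) ⟩
      m ^ R * (m * crowdingBound l p t) ∎

-- The number of sampled triples

#pairs #triples : ℕ → ℕ
#pairs n = ∑[ x < n ] ∑[ y < n ] 𝟙 (x ≺ y)
#triples n = # (ascending {n})

#pairs-formula : ∀ n → 2 * #pairs n + n ≡ n * n
#pairs-formula n = begin
  2 * #pairs n + n
    ≡⟨ cong₂ (λ p s → 2 * p + s)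
         (sum-cong-≗ {n} λ x → sum-cong-≗ {n} λ y → sym (+-identityʳ (𝟙 (x ≺ y)))) (sym ones) ⟩
  2 * e₂ {n} (λ _ → 1) + squares {n} (λ _ → 1)
    ≡⟨ square-of-sum {n} (λ _ → 1) ⟩
  ∑[ x < n ] 1 * ∑[ x < n ] 1
    ≡⟨ cong₂ _*_ ones ones ⟩
  n * n ∎
  where
  open ≡-Reasoning
  ones : ∑[ x < n ] 1 ≡ n
  ones = trans (∑-const n 1) (*-identityʳ n)

#triples-step : ∀ n → #pairs n + #triples n ≤ #triples (suc n)
#triples-step n = +-mono-≤ first (∑-mono {n} λ x → later x)
  where
  first : #pairs n ≤ ∑[ y < suc n ] ∑[ z < suc n ] 𝟙 (ascending zero y z)
  first = m≤n⇒m≤o+n (∑[ z < suc n ] 𝟙 (ascending {suc n} zero zero z))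
    (∑-mono {n} λ y → m≤n⇒m≤o+n (𝟙 (ascending {suc n} zero (suc y) zero)) ≤-refl)
  later : ∀ x → ∑[ y < n ] ∑[ z < n ] 𝟙 (ascending x y z) ≤
                ∑[ y < suc n ] ∑[ z < suc n ] 𝟙 (ascending (suc x) y z)
  later x = m≤n⇒m≤o+n (∑[ z < suc n ] 𝟙 (ascending (suc x) zero z))
    (∑-mono {n} λ y → m≤n⇒m≤o+n (𝟙 (ascending {suc n} (suc x) (suc y) zero)) ≤-refl)

#triples-bound : ∀ n → n ³ ≤ 6 * #triples n + 3 * (n * n)
#triples-bound zero    = z≤n
#triples-bound (suc n) = +-cancelʳ-≤ (3 * n) _ _ (begin
  (1 + n) ³ + 3 * n
    ≤⟨ m≤m+n _ 2 ⟩
  (1 + n) ³ + 3 * n + 2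
    ≡⟨ expand n ⟩
  n ³ + (3 * (n * n) + 6 * n + 3)
    ≤⟨ +-monoˡ-≤ _ (#triples-bound n) ⟩
  6 * #triples n + 3 * (n * n) + (3 * (n * n) + 6 * n + 3)
    ≡⟨ cong (λ s → 6 * #triples n + 3 * s + (3 * (n * n) + 6 * n + 3)) (sym (#pairs-formula n)) ⟩
  6 * #triples n + 3 * (2 * #pairs n + n) + (3 * (n * n) + 6 * n + 3)
    ≡⟨ collect (#triples n) (#pairs n) n ⟩
  6 * (#pairs n + #triples n) + (3 * ((1 + n) * (1 + n)) + 3 * n)
    ≤⟨ +-monoˡ-≤ _ (*-monoʳ-≤ 6 (#triples-step n)) ⟩
  6 * #triples (suc n) + (3 * ((1 + n) * (1 + n)) + 3 * n)
    ≡⟨ +-assoc (6 * #triples (suc n)) _ _ ⟨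
  6 * #triples (suc n) + 3 * ((1 + n) * (1 + n)) + 3 * n ∎)
  where
  open ≤-Reasoning
  expand : ∀ n → (1 + n) * (1 + n) * (1 + n) + 3 * n + 2 ≡ n * n * n + (3 * (n * n) + 6 * n + 3)
  expand = solve-∀
  collect : ∀ t p n → 6 * t + 3 * (2 * p + n) + (3 * (n * n) + 6 * n + 3) ≡
                      6 * (p + t) + (3 * ((1 + n) * (1 + n)) + 3 * n)
  collect = solve-∀

-- Since 3(4m)² = 48m² ≤ 48m³, six times the count is at least 64m³ - 48m³ = 16m³, of which 12m³ is
-- kept.
#triples-4m : ∀ m → 1 ≤ m → 2 * m ³ ≤ #triples (4 * m)
#triples-4m m 1≤m = via (#triples (4 * m)) (#triples-bound (4 * m))
  where
  open ≤-Reasoning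
  expand : ∀ m → 6 * (2 * (m * m * m)) + 48 * (m * m * m) + 4 * (m * m * m) ≡ 4 * m * (4 * m) * (4 * m)
  expand = solve-∀
  expand′ : ∀ m → 3 * (4 * m * (4 * m)) ≡ 48 * (m * m * 1)
  expand′ = solve-∀
  via : ∀ t → (4 * m) ³ ≤ 6 * t + 3 * (4 * m * (4 * m)) → 2 * m ³ ≤ t
  via t h = *-cancelˡ-≤ 6 (+-cancelʳ-≤ (48 * m ³) _ _ (begin
    6 * (2 * m ³) + 48 * m ³                  ≤⟨ m≤m+n _ (4 * m ³) ⟩
    6 * (2 * m ³) + 48 * m ³ + 4 * m ³        ≡⟨ expand m ⟩
    (4 * m) ³                                 ≤⟨ h ⟩
    6 * t + 3 * (4 * m * (4 * m))             ≡⟨ cong (6 * t +_) (expand′ m) ⟩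
    6 * t + 48 * (m * m * 1)                  ≤⟨ +-monoʳ-≤ (6 * t) (*-monoʳ-≤ 48 (*-monoʳ-≤ (m * m) 1≤m)) ⟩
    6 * t + 48 * m ³                          ∎))

-- Because m - q = 11, mN ≥ 11T - m²B ≥ 22m³ - m³. The sampling weight 11 is the least p with 2p - 1
-- ≥ 21.
deletion-arithmetic : ∀ {q T N B cost} → let m = 11 + q in
  T ≤ N + cost → m * cost ≤ q * T + m * m * B → 2 * m ³ ≤ T → B ≤ m → 21 * (m * m) ≤ N
deletion-arithmetic {q} {T} {N} {B} {cost} T≤ cost≤ T≥ B≤m =
  *-cancelˡ-≤ m (+-cancelʳ-≤ (m ³ + q * T) _ _ (begin
    m * (21 * (m * m)) + (m ³ + q * T)     ≡⟨ reorder m q T ⟩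
    11 * (2 * m ³) + q * T                 ≤⟨ +-monoˡ-≤ (q * T) (*-monoʳ-≤ 11 T≥) ⟩
    11 * T + q * T                         ≡⟨ *-distribʳ-+ T 11 q ⟨
    m * T                                  ≤⟨ *-monoʳ-≤ m T≤ ⟩
    m * (N + cost)                         ≡⟨ *-distribˡ-+ m N cost ⟩
    m * N + m * cost                       ≤⟨ +-monoʳ-≤ (m * N) cost≤ ⟩
    m * N + (q * T + m * m * B)            ≤⟨ +-monoʳ-≤ (m * N) (+-monoʳ-≤ (q * T) (*-monoʳ-≤ (m * m) B≤m)) ⟩
    m * N + (q * T + m ³)                  ≡⟨ cong (m * N +_) (+-comm (q * T) (m ³)) ⟩
    m * N + (m ³ + q * T)                  ∎))
  where
  open ≤-Reasoning
  m : ℕ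
  m = 11 + q
  reorder : ∀ m q T → m * (21 * (m * m)) + (m * m * m + q * T) ≡ 11 * (2 * (m * m * m)) + q * T
  reorder = solve-∀

sparse-by-deletion : ∀ l n p q t .{{_ : NonZero (p + q)}} → n ≡ t * (p + q) →
  ∃ λ (M : Relation₃ n) → IsIncreasing M ×
    (∀ s → s < l → (v : Vec (Fin n) (2 + s)) → # (λ x y z → M x y z ∧ member₃ v x y z) ≤ s) ×
    ∃ λ cost → #triples n ≤ # M + cost ×
      (p + q) * cost ≤ q * #triples n + (p + q) * (p + q) * crowdingBound l p t
sparse-by-deletion l n p q t n≡ = build (average-attained p q R cost)
  where
  open Deletion l n p q
  m : ℕ
  m = p + q
  candidates : ∑[ i < R ] 𝟙 (candidate i) ≡ #triples n
  candidates = trans (∑-cell {n} (λ i → 𝟙 (candidate i))) (Σ³-cong λ x y z → cong 𝟙 (uncell-cell (ascending {n}) x y z))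
  cost-bound : ∀ U → m ^ R * cost U ≤ 𝔼 p q R cost →
    m * cost U ≤ q * ∑[ i < R ] 𝟙 (candidate i) + m * m * crowdingBound l p t
  cost-bound U attained = *-cancelˡ-≤ (m ^ R) {{m^n≢0 m R}} (begin
    m ^ R * (m * cost U)        ≡⟨ rotate (m ^ R) m (cost U) ⟩
    m ^ R * cost U * m          ≤⟨ *-monoˡ-≤ m attained ⟩
    𝔼 p q R cost * m            ≤⟨ average-cost t n≡ ⟩
    m ^ R * (q * ∑[ i < R ] 𝟙 (candidate i) + m * m * crowdingBound l p t) ∎)
    where
    open ≤-Reasoning
    rotate : ∀ a b c → a * (b * c) ≡ a * c * b
    rotate = solve-∀
  build : (∃ λ U → m ^ R * cost U ≤ 𝔼 p q R cost) → _
  build (U , attained) = M , M-increasing , M-sparse , cost U ,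
    subst₂ (λ s t → s ≤ t + cost U) candidates (∑-cell {n} (λ i → 𝟙 (kept U i))) (candidates≤kept+cost U) ,
    subst (λ s → m * cost U ≤ q * s + m * m * crowdingBound l p t) candidates (cost-bound U attained)
    where
    M : Relation₃ n
    M x y z = kept U (cell {n} x y z)
    M-increasing : IsIncreasing M
    M-increasing x y z h with c , _ ← kept⇒ U (cell {n} x y z) h
      with p , r ← ∧-split (x ≺ y) (trans (sym (uncell-cell (ascending {n}) x y z)) c) = <ᵇ-true⇒< p , <ᵇ-true⇒< r
    M-sparse : ∀ s → s < l → (v : Vec (Fin n) (2 + s)) → # (λ x y z → M x y z ∧ member₃ v x y z) ≤ s
    M-sparse s s<l v = ≤-trans (≤-reflexive (trans
      (Σ³-cong λ x y z → cong (λ b → 𝟙 (kept U (cell {n} x y z) ∧ b)) (sym (uncell-cell (member₃ v) x y z)))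
      (sym (∑-cell {n} (λ i → 𝟙 (kept U i ∧ uncell {n} (member₃ v) i))))))
      (kept-sparse U s s<l v)

-- Triples are kept with probability 11/m; the constant 21 has to exceed the 20 in blow-up-arithmetic.
sparse-exists : ∀ k → ∃ λ q₀ → ∀ q → q₀ ≤ q → let m = 11 + q in
  ∃ λ (M : Relation₃ (4 * m)) → IsIncreasing M × Sparse k M × 21 * (m * m) ≤ # M
-- The threshold ensures B ≤ m, so that deletions cost at most m² triples. `suc k` occurs because
-- the deletion lemma treats s < l, and 4 because there are 4m labels.
sparse-exists k = crowdingBound (suc k) 11 4 , λ q q₀≤q →
  let M , inc , sparse , cost , T≤ , cost≤ = sparse-by-deletion (suc k) (4 * (11 + q)) 11 q 4 refl in
  M , inc , (λ s s≤k → sparse s (s≤s s≤k)) ,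
  deletion-arithmetic {q} {#triples (4 * (11 + q))} {# M} {crowdingBound (suc k) 11 4} {cost}
    T≤ cost≤ (#triples-4m (11 + q) (s≤s z≤n)) (≤-trans q₀≤q (m≤n+m q 11))

-- 3-graphs as increasing relations

holds : ∀ {n} → Relation₃ n → Triple n → Bool
holds E (x , y , z) = E x y z

match : ∀ {n} → Triple n → Relation₃ n
match (a , b , c) x y z = (a == x) ∧ ((b == y) ∧ (c == z))

match⇒≡ : ∀ {n} (e : Triple n) x y z → match e x y z ≡ true → e ≡ (x , y , z)
match⇒≡ (a , b , c) x y z h
  with p , qr ← ∧-split (a == x) h with q , r ← ∧-split (b == y) qr =
  cong₂ _,_ (==⇒≡ a x p) (cong₂ _,_ (==⇒≡ b y q) (==⇒≡ c z r))

match-refl : ∀ {n} (x y z : Fin n) → match (x , y , z) x y z ≡ true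
match-refl x y z = ∧-true (==-refl x) (∧-true (==-refl y) (==-refl z))

#-match : ∀ {n} (e : Triple n) → # (match e) ≡ 1
#-match (a , b , c) = trans
  (Σ³-cong λ x y z → trans (𝟙-∧ (a == x) _) (cong (𝟙 (a == x) *_) (𝟙-∧ (b == y) (c == z))))
  (trans (Σ³-product (λ x → 𝟙 (a == x)) (λ y → 𝟙 (b == y)) (λ z → 𝟙 (c == z)))
    (cong₂ _*_ (∑-δ′ a) (cong₂ _*_ (∑-δ′ b) (∑-δ′ c))))

listed : ∀ {n} → List (Triple n) → Relation₃ n
listed []      x y z = false
listed (e ∷ L) x y z = match e x y z ∨ listed L x y z

listed⇒∈ : ∀ {n} (L : List (Triple n)) {x y z} → listed L x y z ≡ true → (x , y , z) ∈ L
listed⇒∈ (e ∷ L) {x} {y} {z} h with match e x y z in eq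
... | true  = here (sym (match⇒≡ e x y z eq))
... | false = there (listed⇒∈ L h)

∈⇒listed : ∀ {n} (L : List (Triple n)) {x y z} → (x , y , z) ∈ L → listed L x y z ≡ true
∈⇒listed (e ∷ L) {x} {y} {z} (here refl) rewrite match-refl x y z = refl
∈⇒listed (e ∷ L) {x} {y} {z} (there p)   = ∨-trueʳ (match e x y z) (∈⇒listed L p)

#-listed : ∀ {n} (L : List (Triple n)) → Unique L → # (listed L) ≡ length L
#-listed {n} [] [] = trans (Σ³-cong {n} λ x y z → refl) (∑-zero {n} λ x → ∑-zero {n} λ y → ∑-zero {n} λ z → refl)
#-listed {n} (e ∷ L) (new ∷ unique) = begin
  # (listed (e ∷ L))
    ≡⟨ Σ³-cong (λ x y z → disjoint x y z) ⟩
  Σ³ (λ x y z → 𝟙 (match e x y z) + 𝟙 (listed L x y z))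
    ≡⟨ Σ³-+ (λ x y z → 𝟙 (match e x y z)) (λ x y z → 𝟙 (listed L x y z)) ⟩
  # (match e) + # (listed L)
    ≡⟨ cong₂ _+_ (#-match e) (#-listed L unique) ⟩
  suc (length L) ∎
  where
  open ≡-Reasoning
  disjoint : ∀ x y z → 𝟙 (match e x y z ∨ listed L x y z) ≡ 𝟙 (match e x y z) + 𝟙 (listed L x y z)
  disjoint x y z with match e x y z in eq | listed L x y z in eq′
  ... | false | _     = refl
  ... | true  | false = refl
  ... | true  | true  = contradiction (match⇒≡ e x y z eq) (All.lookup new (listed⇒∈ L eq′))

allTriples : ∀ n → List (Triple n)
allTriples n = cartesianProduct (allFin n) (cartesianProduct (allFin n) (allFin n))

triplesOf : ∀ {n} → Relation₃ n → List (Triple n)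
triplesOf {n} E = filter (λ t → holds E t ≟ᵇ true) (allTriples n)

triplesOf-sound : ∀ {n} (E : Relation₃ n) {t} → t ∈ triplesOf E → holds E t ≡ true
triplesOf-sound {n} E t∈ = proj₂ (∈-filter⁻ (λ t → holds E t ≟ᵇ true) {xs = allTriples n} t∈)

triplesOf-complete : ∀ {n} (E : Relation₃ n) {t} → holds E t ≡ true → t ∈ triplesOf E
triplesOf-complete E {x , y , z} h = ∈-filter⁺ (λ t → holds E t ≟ᵇ true)
  (∈-cartesianProduct⁺ (∈-allFin x) (∈-cartesianProduct⁺ (∈-allFin y) (∈-allFin z))) h

triplesOf-unique : ∀ {n} (E : Relation₃ n) → Unique (triplesOf E)
triplesOf-unique {n} E = Unique.filter⁺ (λ t → holds E t ≟ᵇ true)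
  (Unique.cartesianProduct⁺ (Unique.allFin⁺ n) (Unique.cartesianProduct⁺ (Unique.allFin⁺ n) (Unique.allFin⁺ n)))

graphOf : ∀ {n} (E : Relation₃ n) → IsIncreasing E → Graph3 n
graphOf E inc = record
  { edges      = triplesOf E
  ; increasing = All.tabulate λ t∈ → inc _ _ _ (triplesOf-sound E t∈)
  ; unique     = triplesOf-unique E
  }

#-graphOf : ∀ {n} (E : Relation₃ n) (inc : IsIncreasing E) → ∣E∣ (graphOf E inc) ≡ # E
#-graphOf E inc = trans (sym (#-listed (triplesOf E) (triplesOf-unique E)))
  (Σ³-cong λ x y z → cong 𝟙 (same x y z))
  where
  same : ∀ x y z → listed (triplesOf E) x y z ≡ E x y z
  same x y z with listed (triplesOf E) x y z in eq | E x y z in eq′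
  ... | true  | true  = refl
  ... | false | false = refl
  ... | true  | false = trans (sym (triplesOf-sound E (listed⇒∈ (triplesOf E) eq))) eq′
  ... | false | true  = trans (sym eq) (∈⇒listed (triplesOf E) (triplesOf-complete E eq′))

listed-increasing : ∀ {n} (G : Graph3 n) → IsIncreasing (listed (edges G))
listed-increasing G x y z h = All.lookup (increasing G) (listed⇒∈ (edges G) h)

induced-⊆ : ∀ {k n} (G : Graph3 n) (φ : Fin k → Fin n) → StrictlyMonotone φ →
  (inc : IsIncreasing (pull (listed (edges G)) φ)) → graphOf (pull (listed (edges G)) φ) inc ⊆G G
induced-⊆ G φ mono inc = φ , injective , All.tabulate λ t∈ →
  _ , listed⇒∈ (edges G) (triplesOf-sound (pull (listed (edges G)) φ) t∈) ,
  inj₁ refl , inj₂ (inj₁ refl) , inj₂ (inj₂ refl)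
  where
  injective : Injective _≡_ _≡_ φ
  injective {x} {y} eq with Fin.<-cmp x y
  ... | tri< x<y _ _ = contradiction eq (Fin.<⇒≢ (mono x y x<y))
  ... | tri≈ _ x≡y _ = x≡y
  ... | tri> _ _ y<x = contradiction (sym eq) (Fin.<⇒≢ (mono y x y<x))

-- Copies under maps that need not preserve the order

_⊑_ : ∀ {n} → Triple n → Triple n → Set
e ⊑ t = ∀ v → v ∈₃ e → v ∈₃ t

∈₃-swap : ∀ {n} {v x y z : Fin n} → v ∈₃ (x , y , z) → v ∈₃ (y , x , z)
∈₃-swap (inj₁ p)        = inj₂ (inj₁ p)
∈₃-swap (inj₂ (inj₁ p)) = inj₁ p
∈₃-swap (inj₂ (inj₂ p)) = inj₂ (inj₂ p)

∈₃-rotate : ∀ {n} {v x y z : Fin n} → v ∈₃ (x , y , z) → v ∈₃ (y , z , x)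
∈₃-rotate (inj₁ p)        = inj₂ (inj₂ p)
∈₃-rotate (inj₂ (inj₁ p)) = inj₁ p
∈₃-rotate (inj₂ (inj₂ p)) = inj₂ (inj₁ p)

increasing-determined : ∀ {n} {e e′ : Triple n} → Increasing e → Increasing e′ → e ⊑ e′ → e′ ⊑ e → e ≡ e′
increasing-determined {n} {x , y , z} {x′ , y′ , z′} i i′ sub sub′ =
  cong₂ _,_ x≡x′ (cong₂ _,_ y≡y′ z≡z′)
  where
  smallest : ∀ {v} {x y z : Fin n} → Increasing (x , y , z) → v ∈₃ (x , y , z) → x Fin.≤ v
  smallest (x<y , y<z) (inj₁ refl)        = ≤-refl
  smallest (x<y , y<z) (inj₂ (inj₁ refl)) = <⇒≤ x<y
  smallest (x<y , y<z) (inj₂ (inj₂ refl)) = <⇒≤ (<-trans x<y y<z)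
  largest : ∀ {v} {x y z : Fin n} → Increasing (x , y , z) → v ∈₃ (x , y , z) → v Fin.≤ z
  largest (x<y , y<z) (inj₁ refl)        = <⇒≤ (<-trans x<y y<z)
  largest (x<y , y<z) (inj₂ (inj₁ refl)) = <⇒≤ y<z
  largest (x<y , y<z) (inj₂ (inj₂ refl)) = ≤-refl
  x≡x′ : x ≡ x′
  x≡x′ = Fin.≤-antisym (smallest i (sub′ x′ (inj₁ refl))) (smallest i′ (sub x (inj₁ refl)))
  z≡z′ : z ≡ z′
  z≡z′ = Fin.≤-antisym (largest i′ (sub z (inj₂ (inj₂ refl)))) (largest i (sub′ z′ (inj₂ (inj₂ refl))))
  y≡y′ : y ≡ y′
  y≡y′ with sub y (inj₂ (inj₁ refl))
  ... | inj₁ y≡x′        = contradiction (trans x≡x′ (sym y≡x′)) (Fin.<⇒≢ (proj₁ i))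
  ... | inj₂ (inj₁ y≡y′) = y≡y′
  ... | inj₂ (inj₂ y≡z′) = contradiction (trans y≡z′ (sym z≡z′)) (Fin.<⇒≢ (proj₂ i))

-- The embedding may permute the order inside an edge, while E holds only for the increasing order
-- of the image. The six bijective placements yield the six orders; all others put two vertices in
-- one position and contradict injectivity.
arrange : ∀ {k n} (E : Relation₃ n) (inc : IsIncreasing E) (φ : Fin k → Fin n) → Injective _≡_ _≡_ φ →
  ∀ {e@(x , y , z) : Triple k} → Increasing e → IsEdge (graphOf E inc) (φ x) (φ y) (φ z) →
  ∃ λ t → holds (pull E φ) t ≡ true × e ⊑ t × t ⊑ e
arrange E inc φ inj {x , y , z} (x<y , y<z) ((p , q , r) , e∈ , px , py , pz) = go px py pz
  where
  x≢y : φ x ≢ φ y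
  x≢y = Fin.<⇒≢ x<y ∘ inj
  y≢z : φ y ≢ φ z
  y≢z = Fin.<⇒≢ y<z ∘ inj
  x≢z : φ x ≢ φ z
  x≢z = Fin.<⇒≢ (<-trans x<y y<z) ∘ inj
  edge : ∀ {a b c} → φ a ≡ p → φ b ≡ q → φ c ≡ r → holds (pull E φ) (a , b , c) ≡ true
  edge refl refl refl = triplesOf-sound E e∈
  go : φ x ∈₃ (p , q , r) → φ y ∈₃ (p , q , r) → φ z ∈₃ (p , q , r) →
    ∃ λ t → holds (pull E φ) t ≡ true × (x , y , z) ⊑ t × t ⊑ (x , y , z)
  go (inj₁ a)        (inj₂ (inj₁ b)) (inj₂ (inj₂ c)) = (x , y , z) , edge a b c , (λ _ → id) , (λ _ → id)
  go (inj₁ a)        (inj₂ (inj₂ c)) (inj₂ (inj₁ b)) = (x , z , y) , edge a b c ,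
    (λ _ → ∈₃-rotate ∘ ∈₃-swap) , (λ _ → ∈₃-rotate ∘ ∈₃-swap)
  go (inj₂ (inj₁ b)) (inj₁ a)        (inj₂ (inj₂ c)) = (y , x , z) , edge a b c , (λ _ → ∈₃-swap) , (λ _ → ∈₃-swap)
  go (inj₂ (inj₁ b)) (inj₂ (inj₂ c)) (inj₁ a)        = (z , x , y) , edge a b c ,
    (λ _ → ∈₃-rotate ∘ ∈₃-rotate) , (λ _ → ∈₃-rotate)
  go (inj₂ (inj₂ c)) (inj₁ a)        (inj₂ (inj₁ b)) = (y , z , x) , edge a b c ,
    (λ _ → ∈₃-rotate) , (λ _ → ∈₃-rotate ∘ ∈₃-rotate)
  go (inj₂ (inj₂ c)) (inj₂ (inj₁ b)) (inj₁ a)        = (z , y , x) , edge a b c ,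
    (λ _ → ∈₃-swap ∘ ∈₃-rotate) , (λ _ → ∈₃-swap ∘ ∈₃-rotate)
  go (inj₁ a) (inj₁ b) _ = contradiction (trans a (sym b)) x≢y
  go (inj₂ (inj₁ a)) (inj₂ (inj₁ b)) _ = contradiction (trans a (sym b)) x≢y
  go (inj₂ (inj₂ a)) (inj₂ (inj₂ b)) _ = contradiction (trans a (sym b)) x≢y
  go (inj₁ a) _ (inj₁ b) = contradiction (trans a (sym b)) x≢z
  go (inj₂ (inj₁ a)) _ (inj₂ (inj₁ b)) = contradiction (trans a (sym b)) x≢z
  go (inj₂ (inj₂ a)) _ (inj₂ (inj₂ b)) = contradiction (trans a (sym b)) x≢z
  go _ (inj₁ a) (inj₁ b) = contradiction (trans a (sym b)) y≢z
  go _ (inj₂ (inj₁ a)) (inj₂ (inj₁ b)) = contradiction (trans a (sym b)) y≢z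
  go _ (inj₂ (inj₂ a)) (inj₂ (inj₂ b)) = contradiction (trans a (sym b)) y≢z

-- An increasing triple is determined by its vertex set, so different edges of L have different
-- rearrangements, and F counts each of them. The recursion carries the origin of each rearranged
-- triple to prove this freshness.
length≤# : ∀ {k} (F : Relation₃ k) (L : List (Triple k)) → All Increasing L → Unique L →
  All (λ e → ∃ λ t → holds F t ≡ true × e ⊑ t × t ⊑ e) L → length L ≤ # F
length≤# {k} F L inc unique copies = let L′ , len , unique′ , ok , _ = rearrange L inc unique copies in
  ≤-trans (≤-reflexive (trans (sym len) (sym (#-listed L′ unique′))))
    (Σ³-mono {k} λ x y z → 𝟙-mono {listed L′ x y z} {F x y z} λ h → All.lookup ok (listed⇒∈ L′ h))
  where
  rearrange : ∀ L → All Increasing L → Unique L → All (λ e → ∃ λ t → holds F t ≡ true × e ⊑ t × t ⊑ e) L →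
    ∃ λ L′ → length L′ ≡ length L × Unique L′ × All (λ t → holds F t ≡ true) L′ ×
      (∀ {t} → t ∈ L′ → ∃ λ e → e ∈ L × e ⊑ t × t ⊑ e)
  rearrange [] [] [] [] = [] , refl , [] , [] , λ ()
  rearrange (e ∷ L) (i ∷ inc) (new ∷ unique) ((t , ok , e⊑t , t⊑e) ∷ copies)
    with L′ , len , unique′ , oks , origin ← rearrange L inc unique copies =
    t ∷ L′ , cong suc len , All.tabulate fresh ∷ unique′ , ok ∷ oks ,
    λ { (here refl) → e , here refl , e⊑t , t⊑e
      ; (there t∈)  → let e′ , e′∈ , p = origin t∈ in e′ , there e′∈ , p }
    where
    fresh : ∀ {t′} → t′ ∈ L′ → t ≢ t′
    fresh t∈ refl with e′ , e′∈ , e′⊑t , t⊑e′ ← origin t∈ = All.lookup new e′∈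
      (increasing-determined i (All.lookup inc e′∈) (λ v → t⊑e′ v ∘ e⊑t v) (λ v → t⊑e v ∘ e′⊑t v))

-- Reduces freeness to a count over an arbitrary map. The relation `pull E φ` need not be
-- increasing, which is harmless because `labelling-bound` holds for every labelling.
subgraph-bound : ∀ {k n} (E : Relation₃ n) (inc : IsIncreasing E) (H : Graph3 k) → H ⊆G graphOf E inc →
  ∃ λ (φ : Fin k → Fin n) → ∣E∣ H ≤ # (pull E φ)
subgraph-bound E inc H (φ , inj , copies) = φ ,
  length≤# (pull E φ) (edges H) (increasing H) (unique H)
    (All.zipWith (λ (i , c) → arrange E inc φ inj i c) (increasing H , copies))

-- Labellings and blow-ups

data Label (n m : ℕ) : Set where
  inA : Fin n → Label n m
  inB : Fin m → Label n m
  inC : Label n m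

-- Parts come in the order A, B, C and labels ascend within a part. For an increasing M at most one
-- ordering of three vertices is an edge, so counting ordered triples counts edges once.
pattern-edge : ∀ {n m} → Relation₃ n → Label n m → Label n m → Label n m → Bool
pattern-edge M (inA u) (inA v) (inA w) = M u v w
pattern-edge M (inA u) (inA v) (inB _) = u ≺ v
pattern-edge M (inA u) (inA v) inC     = u ≺ v
pattern-edge M (inA _) (inB v) (inB w) = v ≺ w
pattern-edge M (inA _) (inB _) inC     = true
pattern-edge M (inA _) (inB _) _     = false
pattern-edge M (inA _) inC     _     = false
pattern-edge M (inB u) (inB v) inC     = u ≺ v
pattern-edge M (inB _) (inB _) _     = false
pattern-edge M (inB _) (inA _) _     = false
pattern-edge M (inB _) inC     _     = false
pattern-edge M inC     _     _     = false

∑-labels : ∀ {n m} → (Fin n → ℕ) → (Fin m → ℕ) → ℕ → (Label n m → ℕ) → ℕ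
∑-labels {n} {m} f g c h = ∑[ u < n ] (f u * h (inA u)) + ∑[ v < m ] (g v * h (inB v)) + c * h inC

∑-no-terms : ∀ {n} (f : Fin n → ℕ) → ∑[ u < n ] (f u * 0) ≡ 0
∑-no-terms f = ∑-zero λ u → *-zeroʳ (f u)

module _ {n m} (M : Relation₃ n) (f : Fin n → ℕ) (g : Fin m → ℕ) (c : ℕ) where

  -- The partial sums of the pattern over its last label, and in `second` over its last two, so that
  -- the three coordinates can be summed out one at a time.
  third : Label n m → Label n m → ℕ
  third (inA u) (inA v) = ∑[ w < n ] (f w * 𝟙 (M u v w)) + 𝟙 (u ≺ v) * (sum g + c)
  third (inA u) (inB v) = ∑[ w < m ] (g w * 𝟙 (v ≺ w)) + c
  third (inB u) (inB v) = c * 𝟙 (u ≺ v)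
  third _     _     = 0

  second : Label n m → ℕ
  second (inA u) = ∑[ v < n ] (f v * ∑[ w < n ] (f w * 𝟙 (M u v w))) +
                 ∑[ v < n ] (f v * 𝟙 (u ≺ v)) * (sum g + c) + (e₂ g + sum g * c)
  second (inB u) = c * ∑[ v < m ] (g v * 𝟙 (u ≺ v))
  second inC     = 0

  no-labels : ∑-labels f g c (λ _ → 0) ≡ 0
  no-labels rewrite ∑-no-terms f | ∑-no-terms g = *-zeroʳ c

  sum-third : ∀ a b → ∑-labels f g c (λ d → 𝟙 (pattern-edge M a b d)) ≡ third a b
  sum-third (inA u) (inA v) = trans
    (cong (λ s → ∑[ w < n ] (f w * 𝟙 (M u v w)) + s + c * 𝟙 (u ≺ v)) (∑-*ʳ (𝟙 (u ≺ v)) g))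
    (collect (∑[ w < n ] (f w * 𝟙 (M u v w))) (sum g) (𝟙 (u ≺ v)) c)
    where
    collect : ∀ s b i c → s + b * i + c * i ≡ s + i * (b + c)
    collect = solve-∀
  sum-third (inA u) (inB v) rewrite ∑-no-terms f | *-identityʳ c = refl
  sum-third (inA u) inC     = no-labels
  sum-third (inB u) (inA v) = no-labels
  sum-third (inB u) (inB v) rewrite ∑-no-terms f | ∑-no-terms g = refl
  sum-third (inB u) inC     = no-labels
  sum-third inC     b     = no-labels

  sum-second : ∀ a → ∑-labels f g c (third a) ≡ second a
  sum-second (inA u) = trans (cong₂ _+_ (cong₂ _+_ first next) (*-zeroʳ c))
    (+-identityʳ _)
    where
    first : ∑[ v < n ] (f v * (∑[ w < n ] (f w * 𝟙 (M u v w)) + 𝟙 (u ≺ v) * (sum g + c))) ≡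
            ∑[ v < n ] (f v * ∑[ w < n ] (f w * 𝟙 (M u v w))) + ∑[ v < n ] (f v * 𝟙 (u ≺ v)) * (sum g + c)
    first = trans
      (sum-cong-≗ λ v → trans (*-distribˡ-+ (f v) (∑[ w < n ] (f w * 𝟙 (M u v w))) (𝟙 (u ≺ v) * (sum g + c)))
        (cong (f v * ∑[ w < n ] (f w * 𝟙 (M u v w)) +_) (sym (*-assoc (f v) (𝟙 (u ≺ v)) (sum g + c)))))
      (trans (∑-distrib-+ (λ v → f v * ∑[ w < n ] (f w * 𝟙 (M u v w))) (λ v → f v * 𝟙 (u ≺ v) * (sum g + c)))
        (cong (∑[ v < n ] (f v * ∑[ w < n ] (f w * 𝟙 (M u v w))) +_)
          (∑-*ʳ (sum g + c) (λ v → f v * 𝟙 (u ≺ v)))))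
    next : ∑[ v < m ] (g v * (∑[ w < m ] (g w * 𝟙 (v ≺ w)) + c)) ≡ e₂ g + sum g * c
    next = trans
      (sum-cong-≗ λ v → trans (*-distribˡ-+ (g v) (∑[ w < m ] (g w * 𝟙 (v ≺ w))) c)
        (cong (_+ g v * c) (trans (sym (∑-*ˡ (g v) (λ w → g w * 𝟙 (v ≺ w))))
          (sum-cong-≗ λ w → sym (*-assoc (g v) (g w) (𝟙 (v ≺ w)))))))
      (trans (∑-distrib-+ (λ v → ∑[ w < m ] (g v * g w * 𝟙 (v ≺ w))) (λ v → g v * c))
        (cong (e₂ g +_) (∑-*ʳ c g)))
  sum-second (inB u) rewrite ∑-no-terms f | *-zeroʳ c = trans (+-identityʳ _)
    (trans (sum-cong-≗ λ v → rotate (g v) c (𝟙 (u ≺ v))) (∑-*ˡ c (λ v → g v * 𝟙 (u ≺ v))))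
    where
    rotate : ∀ a b c → a * (b * c) ≡ b * (a * c)
    rotate = solve-∀
  sum-second inC     = no-labels

  sum-first : ∑-labels f g c second ≡ pattern-# M f g c
  sum-first = trans (cong₂ _+_ (cong₂ _+_ first next) (*-zeroʳ c))
    (collect (weighted-# M f) (e₂ f) (sum g) c (sum f) (e₂ g))
    where
    collect : ∀ h p b c a q → h + p * (b + c) + a * (q + b * c) + c * q + 0 ≡
              p * b + a * q + p * c + a * b * c + q * c + h
    collect = solve-∀
    sparse-part : ∀ u → f u * ∑[ v < n ] (f v * ∑[ w < n ] (f w * 𝟙 (M u v w))) ≡
      ∑[ v < n ] ∑[ w < n ] (f u * (f v * f w) * 𝟙 (M u v w))
    sparse-part u = trans (sym (∑-*ˡ (f u) (λ v → f v * ∑[ w < n ] (f w * 𝟙 (M u v w)))))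
      (sum-cong-≗ λ v → trans (sym (*-assoc (f u) (f v) _))
        (trans (sym (∑-*ˡ (f u * f v) (λ w → f w * 𝟙 (M u v w))))
          (sum-cong-≗ λ w → reassociate (f u) (f v) (f w) (𝟙 (M u v w)))))
      where
      reassociate : ∀ a b c d → a * b * (c * d) ≡ a * (b * c) * d
      reassociate = solve-∀
    pair-part : ∀ {l} (h : Fin l → ℕ) u → h u * ∑[ v < l ] (h v * 𝟙 (u ≺ v)) ≡ ∑[ v < l ] (h u * h v * 𝟙 (u ≺ v))
    pair-part h u = trans (sym (∑-*ˡ (h u) (λ v → h v * 𝟙 (u ≺ v))))
      (sum-cong-≗ λ v → sym (*-assoc (h u) (h v) (𝟙 (u ≺ v))))
    first : ∑[ u < n ] (f u * second (inA u)) ≡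
            weighted-# M f + e₂ f * (sum g + c) + sum f * (e₂ g + sum g * c)
    first = trans
      (sum-cong-≗ λ u → trans (expand (f u) _ _ (sum g + c) (e₂ g + sum g * c))
        (cong₂ (λ s t → s + t * (sum g + c) + f u * (e₂ g + sum g * c)) (sparse-part u) (pair-part f u)))
      (trans (∑-distrib-+ (λ u → ∑[ v < n ] ∑[ w < n ] (f u * (f v * f w) * 𝟙 (M u v w)) + ∑[ v < n ] (f u * f v * 𝟙 (u ≺ v)) * (sum g + c)) (λ u → f u * (e₂ g + sum g * c)))
        (cong₂ _+_
          (trans (∑-distrib-+ (λ u → ∑[ v < n ] ∑[ w < n ] (f u * (f v * f w) * 𝟙 (M u v w))) (λ u → ∑[ v < n ] (f u * f v * 𝟙 (u ≺ v)) * (sum g + c)))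
            (cong (weighted-# M f +_) (∑-*ʳ (sum g + c) (λ u → ∑[ v < n ] (f u * f v * 𝟙 (u ≺ v))))))
          (∑-*ʳ (e₂ g + sum g * c) f)))
      where
      expand : ∀ x s t d r → x * (s + t * d + r) ≡ x * s + x * t * d + x * r
      expand = solve-∀
    next : ∑[ u < m ] (g u * second (inB u)) ≡ c * e₂ g
    next = trans
      (sum-cong-≗ λ u → trans (rotate (g u) c (∑[ v < m ] (g v * 𝟙 (u ≺ v)))) (cong (c *_) (pair-part g u)))
      (∑-*ˡ c (λ u → ∑[ v < m ] (g u * g v * 𝟙 (u ≺ v))))
      where
      rotate : ∀ a b c → a * (b * c) ≡ b * (a * c)
      rotate = solve-∀

  -- The number of edges depends only on how often each label occurs. The hypothesis puts this as a
  -- change of variables, supplied by `label-count` for arbitrary labellings and by `blocks-count`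
  -- for the blow-up.
  pattern-count : ∀ {k} (ℓ : Fin k → Label n m) → (∀ h → ∑[ i < k ] h (ℓ i) ≡ ∑-labels f g c h) →
    # (pull (pattern-edge M) ℓ) ≡ pattern-# M f g c
  pattern-count {k} ℓ count = trans
    (sum-cong-≗ λ i → trans
      (sum-cong-≗ λ j → trans (count (λ d → 𝟙 (pattern-edge M (ℓ i) (ℓ j) d))) (sum-third (ℓ i) (ℓ j)))
      (trans (count (third (ℓ i))) (sum-second (ℓ i))))
    (trans (count second) sum-first)

is-A : ∀ {n m} → Fin n → Label n m → Bool
is-A u (inA v) = v == u
is-A u _     = false

is-B : ∀ {n m} → Fin m → Label n m → Bool
is-B u (inB v) = v == u
is-B u _     = false

is-C : ∀ {n m} → Label n m → Bool
is-C inC = true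
is-C _ = false

label-split : ∀ {n m} (h : Label n m → ℕ) a →
  h a ≡ ∑[ u < n ] (𝟙 (is-A u a) * h (inA u)) + ∑[ u < m ] (𝟙 (is-B u a) * h (inB u)) + 𝟙 (is-C a) * h inC
label-split {n} {m} h (inA v) = sym (trans (+-identityʳ _) (trans (cong₂ _+_
  (trans (sum-cong-≗ λ u → trans (*-comm (𝟙 (v == u)) (h (inA u))) (cong (λ b → h (inA u) * 𝟙 b) (==-sym v u))) (∑-δ (h ∘ inA) v))
  (∑-zero {m} λ u → refl)) (+-identityʳ _)))
label-split {n} {m} h (inB v) = sym (trans (+-identityʳ _) (cong₂ _+_ (∑-zero {n} λ u → refl)
  (trans (sum-cong-≗ λ u → trans (*-comm (𝟙 (v == u)) (h (inB u))) (cong (λ b → h (inB u) * 𝟙 b) (==-sym v u))) (∑-δ (h ∘ inB) v))))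
label-split {n} {m} h inC = sym (trans (cong₂ (λ s t → s + t + (h inC + 0)) (∑-zero {n} λ u → refl) (∑-zero {m} λ u → refl)) (+-identityʳ (h inC)))

label-count : ∀ {n m k} (ℓ : Fin k → Label n m) (h : Label n m → ℕ) → ∑[ i < k ] h (ℓ i) ≡
  ∑-labels (λ u → ∑[ i < k ] 𝟙 (is-A u (ℓ i))) (λ u → ∑[ i < k ] 𝟙 (is-B u (ℓ i))) (∑[ i < k ] 𝟙 (is-C (ℓ i))) h
label-count {n} {m} {k} ℓ h = begin
  ∑[ i < k ] h (ℓ i)
    ≡⟨ sum-cong-≗ (λ i → label-split h (ℓ i)) ⟩
  ∑[ i < k ] (∑[ u < n ] (𝟙 (is-A u (ℓ i)) * h (inA u)) + ∑[ u < m ] (𝟙 (is-B u (ℓ i)) * h (inB u)) + 𝟙 (is-C (ℓ i)) * h inC)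
    ≡⟨ ∑-distrib-+ (λ i → ∑[ u < n ] (𝟙 (is-A u (ℓ i)) * h (inA u)) + ∑[ u < m ] (𝟙 (is-B u (ℓ i)) * h (inB u))) (λ i → 𝟙 (is-C (ℓ i)) * h inC) ⟩
  ∑[ i < k ] (∑[ u < n ] (𝟙 (is-A u (ℓ i)) * h (inA u)) + ∑[ u < m ] (𝟙 (is-B u (ℓ i)) * h (inB u))) + ∑[ i < k ] (𝟙 (is-C (ℓ i)) * h inC)
    ≡⟨ cong₂ _+_ (∑-distrib-+ (λ i → ∑[ u < n ] (𝟙 (is-A u (ℓ i)) * h (inA u))) (λ i → ∑[ u < m ] (𝟙 (is-B u (ℓ i)) * h (inB u))))
         (∑-*ʳ (h inC) (λ i → 𝟙 (is-C (ℓ i)))) ⟩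
  ∑[ i < k ] ∑[ u < n ] (𝟙 (is-A u (ℓ i)) * h (inA u)) + ∑[ i < k ] ∑[ u < m ] (𝟙 (is-B u (ℓ i)) * h (inB u)) + γ * h inC
    ≡⟨ cong₂ (λ s t → s + t + γ * h inC)
         (trans (∑-comm λ i u → 𝟙 (is-A u (ℓ i)) * h (inA u)) (sum-cong-≗ λ u → ∑-*ʳ (h (inA u)) (λ i → 𝟙 (is-A u (ℓ i)))))
         (trans (∑-comm λ i u → 𝟙 (is-B u (ℓ i)) * h (inB u)) (sum-cong-≗ λ u → ∑-*ʳ (h (inB u)) (λ i → 𝟙 (is-B u (ℓ i))))) ⟩
  ∑-labels (λ u → ∑[ i < k ] 𝟙 (is-A u (ℓ i))) (λ u → ∑[ i < k ] 𝟙 (is-B u (ℓ i))) γ h ∎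
  where
  open ≡-Reasoning
  γ : ℕ
  γ = ∑[ i < k ] 𝟙 (is-C (ℓ i))

-- Composing a map into the blow-up with its labels gives such an ℓ, so this bounds every k-vertex
-- subgraph of every blow-up, whatever the block sizes. The form `2 + n` supplies two labels to
-- `largest-two`.
labelling-bound : ∀ {n m k} (M : Relation₃ (2 + n)) → IsIncreasing M → Sparse k M →
  (ℓ : Fin k → Label (2 + n) m) → 486 * # (pull (pattern-edge M) ℓ) ≤ 64 * k ³
labelling-bound {n} {m} {k} M inc sparse ℓ =
  subst₂ (λ s t → 486 * s ≤ 64 * t ³) (sym (pattern-count M f g c ℓ (label-count ℓ))) total
    (pattern-#-bound M inc sparse f g c
      (m+n≤o⇒m≤o (sum f) (m+n≤o⇒m≤o (sum f + sum g) (≤-reflexive total))) (largest-two f))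
  where
  f : Fin (2 + n) → ℕ
  f u = ∑[ i < k ] 𝟙 (is-A u (ℓ i))
  g : Fin m → ℕ
  g u = ∑[ i < k ] 𝟙 (is-B u (ℓ i))
  c : ℕ
  c = ∑[ i < k ] 𝟙 (is-C (ℓ i))
  total : sum f + sum g + c ≡ k
  total = sym (trans (sym (trans (∑-const k 1) (*-identityʳ k))) (trans (label-count ℓ (λ _ → 1))
    (cong₂ _+_ (cong₂ _+_ (sum-cong-≗ λ u → *-identityʳ (f u)) (sum-cong-≗ λ u → *-identityʳ (g u))) (*-identityʳ c))))

-- Q consecutive blocks of q vertices labelled A, then Q such blocks labelled B, then r vertices C.
blocks : ∀ Q q r → Fin (Q * q + (Q * q + r)) → Label Q Q
blocks Q q r = [ inA ∘ quotient q , [ inB ∘ quotient q , (λ _ → inC) ]′ ∘ splitAt (Q * q) ]′ ∘ splitAt (Q * q)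

∑-quotient : ∀ Q q (h : Fin Q → ℕ) → ∑[ i < Q * q ] h (quotient q i) ≡ ∑[ u < Q ] (q * h u)
∑-quotient Q q h = trans (∑-combine Q q (λ i → h (quotient q i)))
  (sum-cong-≗ {Q} λ u → trans
    (sum-cong-≗ {q} λ j → cong (h ∘ proj₁) (Fin.remQuot-combine {Q} {q} u j)) (∑-const q (h u)))

blocks-count : ∀ Q q r (h : Label Q Q → ℕ) →
  ∑[ i < Q * q + (Q * q + r) ] h (blocks Q q r i) ≡ ∑-labels (λ _ → q) (λ _ → q) r h
blocks-count Q q r h = begin
  ∑[ i < Q * q + (Q * q + r) ] h (blocks Q q r i)
    ≡⟨ ∑-split (Q * q) (h ∘ blocks Q q r) ⟩
  ∑[ i < Q * q ] h (blocks Q q r (i ↑ˡ (Q * q + r))) + ∑[ j < Q * q + r ] h (blocks Q q r ((Q * q) ↑ʳ j))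
    ≡⟨ cong₂ _+_
         (trans (sum-cong-≗ λ i → cong (h ∘ [ inA ∘ quotient q , BC ]′) (Fin.splitAt-↑ˡ (Q * q) i (Q * q + r)))
           (∑-quotient Q q (h ∘ inA)))
         (trans (sum-cong-≗ λ j → cong (h ∘ [ inA ∘ quotient q , BC ]′) (Fin.splitAt-↑ʳ (Q * q) (Q * q + r) j))
           rest) ⟩
  ∑[ u < Q ] (q * h (inA u)) + (∑[ u < Q ] (q * h (inB u)) + r * h inC)
    ≡⟨ +-assoc (∑[ u < Q ] (q * h (inA u))) _ _ ⟨
  ∑-labels (λ _ → q) (λ _ → q) r h ∎
  where
  open ≡-Reasoning
  BC : Fin (Q * q + r) → Label Q Q
  BC = [ inB ∘ quotient q , (λ _ → inC) ]′ ∘ splitAt (Q * q)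
  rest : ∑[ j < Q * q + r ] h (BC j) ≡ ∑[ u < Q ] (q * h (inB u)) + r * h inC
  rest = trans (∑-split (Q * q) (h ∘ BC)) (cong₂ _+_
    (trans (sum-cong-≗ λ i → cong (h ∘ [ inB ∘ quotient q , (λ _ → inC) ]′) (Fin.splitAt-↑ˡ (Q * q) i r))
      (∑-quotient Q q (h ∘ inB)))
    (trans (sum-cong-≗ λ j → cong (h ∘ [ inB ∘ quotient q , (λ _ → inC) ]′) (Fin.splitAt-↑ʳ (Q * q) r j))
      (∑-const r (h inC))))

-- The order in which the blocks are laid out. It is strict, since vertices with the same label may
-- come in either order and no edge contains two of them.
_◁_ : ∀ {n m} → Label n m → Label n m → Set
inA u ◁ inA v = u Fin.< v
inA _ ◁ _   = ⊤
inB u ◁ inB v = u Fin.< v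
inB _ ◁ inA _ = ⊥
inB _ ◁ inC   = ⊤
inC   ◁ _   = ⊥

pattern-edge⇒◁ : ∀ {n m} (M : Relation₃ n) → IsIncreasing M → ∀ (a b c : Label n m) →
  pattern-edge M a b c ≡ true → a ◁ b × b ◁ c
pattern-edge⇒◁ M inc (inA u) (inA v) (inA w) h = inc u v w h
pattern-edge⇒◁ M inc (inA u) (inA v) (inB _) h = <ᵇ-true⇒< h , _
pattern-edge⇒◁ M inc (inA u) (inA v) inC     h = <ᵇ-true⇒< h , _
pattern-edge⇒◁ M inc (inA _) (inB v) (inB w) h = _ , <ᵇ-true⇒< h
pattern-edge⇒◁ M inc (inA _) (inB _) inC     h = _ , _
pattern-edge⇒◁ M inc (inB u) (inB v) inC     h = <ᵇ-true⇒< h , _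

quotient-reflects-< : ∀ {Q} q (i j : Fin (Q * q)) → quotient {Q} q i Fin.< quotient {Q} q j → i Fin.< j
quotient-reflects-< {Q} q i j lt = subst₂ Fin._<_ (Fin.combine-remQuot {Q} q i) (Fin.combine-remQuot {Q} q j)
  (Fin.combine-monoˡ-< (remainder {Q} q i) (remainder {Q} q j) lt)

↑ˡ<↑ʳ : ∀ {m n} (i : Fin m) (j : Fin n) → (i ↑ˡ n) Fin.< (m ↑ʳ j)
↑ˡ<↑ʳ {m} {n} i j = subst₂ _<_ (sym (Fin.toℕ-↑ˡ i n)) (sym (Fin.toℕ-↑ʳ m j))
  (<-≤-trans (Fin.toℕ<n i) (m≤m+n m (toℕ j)))

↑ˡ-mono : ∀ {m} n {i j : Fin m} → i Fin.< j → (i ↑ˡ n) Fin.< (j ↑ˡ n)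
↑ˡ-mono n {i} {j} = subst₂ _<_ (sym (Fin.toℕ-↑ˡ i n)) (sym (Fin.toℕ-↑ˡ j n))

↑ʳ-mono : ∀ m {n} {i j : Fin n} → i Fin.< j → (m ↑ʳ i) Fin.< (m ↑ʳ j)
↑ʳ-mono m {i = i} {j} lt = subst₂ _<_ (sym (Fin.toℕ-↑ʳ m i)) (sym (Fin.toℕ-↑ʳ m j)) (+-monoʳ-< m lt)

blocks-reflects-◁ : ∀ Q q r x y → blocks Q q r x ◁ blocks Q q r y → x Fin.< y
blocks-reflects-◁ Q q r x y lt with splitAt (Q * q) x in ex | splitAt (Q * q) y in ey
... | inj₁ i | inj₁ j = subst₂ Fin._<_ (Fin.splitAt⁻¹-↑ˡ ex) (Fin.splitAt⁻¹-↑ˡ ey)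
  (↑ˡ-mono (Q * q + r) (quotient-reflects-< {Q} q i j lt))
... | inj₁ i | inj₂ j = subst₂ Fin._<_ (Fin.splitAt⁻¹-↑ˡ ex) (Fin.splitAt⁻¹-↑ʳ {Q * q} ey) (↑ˡ<↑ʳ i j)
... | inj₂ i | inj₁ j with splitAt (Q * q) i
...   | inj₁ _ = ⊥-elim lt
...   | inj₂ _ = ⊥-elim lt
blocks-reflects-◁ Q q r x y lt | inj₂ i | inj₂ j =
  subst₂ Fin._<_ (Fin.splitAt⁻¹-↑ʳ {Q * q} ex) (Fin.splitAt⁻¹-↑ʳ {Q * q} ey) (↑ʳ-mono (Q * q) (inner lt))
  where
  BC : Fin (Q * q + r) → Label Q Q
  BC = [ inB ∘ quotient q , (λ _ → inC) ]′ ∘ splitAt (Q * q)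
  inner : BC i ◁ BC j → i Fin.< j
  inner lt with splitAt (Q * q) i in ei | splitAt (Q * q) j in ej
  ... | inj₁ s | inj₁ t = subst₂ Fin._<_ (Fin.splitAt⁻¹-↑ˡ ei) (Fin.splitAt⁻¹-↑ˡ ej)
    (↑ˡ-mono r (quotient-reflects-< {Q} q s t lt))
  ... | inj₁ s | inj₂ t = subst₂ Fin._<_ (Fin.splitAt⁻¹-↑ˡ ei) (Fin.splitAt⁻¹-↑ʳ {Q * q} ej) (↑ˡ<↑ʳ s t)
  ... | inj₂ _ | inj₁ _ = ⊥-elim lt
  ... | inj₂ _ | inj₂ _ = ⊥-elim lt

blow-up : ∀ Q q r → Relation₃ Q → Relation₃ (Q * q + (Q * q + r))
blow-up Q q r M = pull (pattern-edge M) (blocks Q q r)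

blow-up-increasing : ∀ Q q r (M : Relation₃ Q) → IsIncreasing M → IsIncreasing (blow-up Q q r M)
blow-up-increasing Q q r M inc x y z h
  with xy , yz ← pattern-edge⇒◁ M inc (blocks Q q r x) (blocks Q q r y) (blocks Q q r z) h =
  blocks-reflects-◁ Q q r x y xy , blocks-reflects-◁ Q q r y z yz

e₂-const : ∀ Q q → e₂ {Q} (λ _ → q) ≡ q * q * e₂ {Q} (λ _ → 1)
e₂-const Q q = trans
  (sum-cong-≗ {Q} λ u → trans (sum-cong-≗ {Q} λ v → cong (q * q *_) (sym (+-identityʳ (𝟙 (u ≺ v)))))
    (∑-*ˡ {Q} (q * q) (λ v → 1 * 1 * 𝟙 (u ≺ v))))
  (∑-*ˡ {Q} (q * q) (λ u → ∑[ v < Q ] (1 * 1 * 𝟙 (u ≺ v))))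

blow-up-# : ∀ Q q r (M : Relation₃ Q) → let p = q * q * e₂ {Q} (λ _ → 1) in
  # (blow-up Q q r M) ≡ p * (Q * q) + Q * q * p + p * r + Q * q * (Q * q) * r + p * r + q * (q * q) * # M
blow-up-# Q q r M = trans (pattern-count M (λ _ → q) (λ _ → q) r (blocks Q q r) (blocks-count Q q r))
  (cong₂ (λ (s , p) h → p * s + s * p + p * r + s * s * r + p * r + h)
    (cong₂ _,_ (∑-const Q q) (e₂-const Q q)) (Σ³-*ˡ (q * (q * q)) (λ x y z → 𝟙 (M x y z))))

-- Numerical estimates

2*[2+N]C2 : ∀ N → 2 * ((2 + N) C 2) ≡ (2 + N) * (1 + N)
2*[2+N]C2 zero    = refl
2*[2+N]C2 (suc N) = begin
  2 * ((3 + N) C 2)                       ≡⟨ cong (2 *_) (nCk+nC[k+1]≡[n+1]C[k+1] (2 + N) 1) ⟨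
  2 * ((2 + N) C 1 + (2 + N) C 2)         ≡⟨ *-distribˡ-+ 2 ((2 + N) C 1) ((2 + N) C 2) ⟩
  2 * ((2 + N) C 1) + 2 * ((2 + N) C 2)   ≡⟨ cong₂ (λ s t → 2 * s + t) (nC1≡n (2 + N)) (2*[2+N]C2 N) ⟩
  2 * (2 + N) + (2 + N) * (1 + N)         ≡⟨ collect N ⟩
  (3 + N) * (2 + N)                       ∎
  where
  open ≡-Reasoning
  collect : ∀ N → 2 * (2 + N) + (2 + N) * (1 + N) ≡ (3 + N) * (2 + N)
  collect = solve-∀

6*[3+N]C3 : ∀ N → 6 * ((3 + N) C 3) ≡ (3 + N) * (2 + N) * (1 + N)
6*[3+N]C3 zero    = refl
6*[3+N]C3 (suc N) = begin
  6 * ((4 + N) C 3)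
    ≡⟨ cong (6 *_) (nCk+nC[k+1]≡[n+1]C[k+1] (3 + N) 2) ⟨
  6 * ((3 + N) C 2 + (3 + N) C 3)
    ≡⟨ *-distribˡ-+ 6 ((3 + N) C 2) ((3 + N) C 3) ⟩
  6 * ((3 + N) C 2) + 6 * ((3 + N) C 3)
    ≡⟨ cong (_+ 6 * ((3 + N) C 3)) (*-assoc 3 2 ((3 + N) C 2)) ⟩
  3 * (2 * ((3 + N) C 2)) + 6 * ((3 + N) C 3)
    ≡⟨ cong₂ (λ s t → 3 * s + t) (2*[2+N]C2 (suc N)) (6*[3+N]C3 N) ⟩
  3 * ((3 + N) * (2 + N)) + (3 + N) * (2 + N) * (1 + N)
    ≡⟨ collect N ⟩
  (4 + N) * (3 + N) * (2 + N) ∎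
  where
  open ≡-Reasoning
  collect : ∀ N → 3 * ((3 + N) * (2 + N)) + (3 + N) * (2 + N) * (1 + N) ≡ (4 + N) * (3 + N) * (2 + N)
  collect = solve-∀

6*nC3 : ∀ j κ → (j + (3 + κ)) * (j + (2 + κ)) * (j + (1 + κ)) ≡ 6 * ((j + (3 + κ)) C 3)
6*nC3 j κ rewrite +-comm j (3 + κ) | +-comm j (2 + κ) | +-comm j (1 + κ) = sym (6*[3+N]C3 (κ + j))

6*nC3≤n³ : ∀ n → 3 ≤ n → 6 * (n C 3) ≤ n ³
6*nC3≤n³ n 3≤n with N , refl ← m≤n⇒∃[o]m+o≡n 3≤n = ≤-trans (≤-reflexive (6*[3+N]C3 N))
  (*-mono-≤ (*-monoʳ-≤ (3 + N) (m≤n+m (2 + N) 1)) (m≤n+m (1 + N) 2))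

-- Averaging from k vertices costs the factor k²/((k - 1)(k - 2)). For k = 10 + 8d one has k - 2 =
-- 8(1 + d), which is large enough to keep the excess over 64/81 within 1/(2(1 + d)).
upper-arithmetic : ∀ d {e M c P} → let κ = 7 + 8 * d in
  e * ((3 + κ) * (2 + κ) * (1 + κ)) ≤ M * P → P ≡ 6 * c → 486 * M ≤ 64 * (3 + κ) ³ →
  e * (162 * (1 + d)) ≤ (128 * (1 + d) + 81) * c
upper-arithmetic d {e} {M} {c} h refl M≤ =
  *-cancelʳ-≤ _ _ (24 * (10 + 8 * d) * (9 + 8 * d)) (begin
    e * (162 * (1 + d)) * (24 * (10 + 8 * d) * (9 + 8 * d))
      ≡⟨ lhs e d ⟩
    486 * (e * ((10 + 8 * d) * (9 + 8 * d) * (8 + 8 * d)))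
      ≤⟨ *-monoʳ-≤ 486 h ⟩
    486 * (M * (6 * c))
      ≡⟨ *-assoc 486 M (6 * c) ⟨
    486 * M * (6 * c)
      ≤⟨ *-monoˡ-≤ (6 * c) M≤ ⟩
    64 * (10 + 8 * d) ³ * (6 * c)
      ≤⟨ m≤m+n _ (24 * (10 + 8 * d) * c * (281 + 264 * d)) ⟩
    64 * (10 + 8 * d) ³ * (6 * c) + 24 * (10 + 8 * d) * c * (281 + 264 * d)
      ≡⟨ rhs c d ⟩
    (128 * (1 + d) + 81) * c * (24 * (10 + 8 * d) * (9 + 8 * d)) ∎)
  where
  open ≤-Reasoning
  lhs : ∀ e d → e * (162 * (1 + d)) * (24 * (10 + 8 * d) * (9 + 8 * d)) ≡
                486 * (e * ((10 + 8 * d) * (9 + 8 * d) * (8 + 8 * d)))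
  lhs = solve-∀
  rhs : ∀ c d → 64 * ((10 + 8 * d) * (10 + 8 * d) * (10 + 8 * d)) * (6 * c) + 24 * (10 + 8 * d) * c * (281 + 264 * d) ≡
                (128 * (1 + d) + 81) * c * (24 * (10 + 8 * d) * (9 + 8 * d))
  rhs = solve-∀

-- The term 20m²q³ is the number of pattern edges lost because an edge needs distinct labels.
blow-up-arithmetic : ∀ {m q r e N} → e + 2 * m ≡ 8 * (m * m) → m * q ≤ r → 21 * (m * m) ≤ N →
  let p = q * q * e ; s = 4 * m * q in
  q * q * q * (m * m * (96 * m + 1)) ≤ p * s + s * p + p * r + s * s * r + p * r + q * (q * q) * N
blow-up-arithmetic {m} {q} {r} {e} {N} pairs mq≤r N≥ = +-cancelʳ-≤ (20 * m * m * (q * q * q)) _ _ (begin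
  -- 96 is half of `Ψ 4 4 1`, the edge count of the pattern at sizes 4 : 4 : 1 in units of (mq)³.
  -- The summand 1 is the net surplus 21 - 20.
  q * q * q * (m * m * (96 * m + 1)) + 20 * m * m * (q * q * q)
    ≡⟨ split m q ⟩
  10 * m * (q * q * q) * (8 * (m * m)) + 16 * (m * m * m) * (q * q * q) + q * (q * q) * (21 * (m * m))
    ≡⟨ cong (λ t → 10 * m * (q * q * q) * t + 16 * (m * m * m) * (q * q * q) + q * (q * q) * (21 * (m * m))) (sym pairs) ⟩
  10 * m * (q * q * q) * (e + 2 * m) + 16 * (m * m * m) * (q * q * q) + q * (q * q) * (21 * (m * m))
    ≡⟨ merge m q e ⟩
  (2 * (q * q * e) + s * s) * (m * q) + (2 * (q * q * e) * s + q * (q * q) * (21 * (m * m))) + 20 * m * m * (q * q * q)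
    ≤⟨ +-monoˡ-≤ (20 * m * m * (q * q * q)) (+-mono-≤ (*-monoʳ-≤ (2 * (q * q * e) + s * s) mq≤r)
         (+-monoʳ-≤ (2 * (q * q * e) * s) (*-monoʳ-≤ (q * (q * q)) N≥))) ⟩
  (2 * (q * q * e) + s * s) * r + (2 * (q * q * e) * s + q * (q * q) * N) + 20 * m * m * (q * q * q)
    ≡⟨ cong (_+ 20 * m * m * (q * q * q)) (expand (q * q * e) s r (q * (q * q) * N)) ⟩
  (q * q * e) * s + s * (q * q * e) + (q * q * e) * r + s * s * r + (q * q * e) * r + q * (q * q) * N + 20 * m * m * (q * q * q) ∎)
  where
  open ≤-Reasoning
  s : ℕ
  s = 4 * m * q
  split : ∀ m q → q * q * q * (m * m * (96 * m + 1)) + 20 * m * m * (q * q * q) ≡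
    10 * m * (q * q * q) * (8 * (m * m)) + 16 * (m * m * m) * (q * q * q) + q * (q * q) * (21 * (m * m))
  split = solve-∀
  merge : ∀ m q e → 10 * m * (q * q * q) * (e + 2 * m) + 16 * (m * m * m) * (q * q * q) + q * (q * q) * (21 * (m * m)) ≡
    (2 * (q * q * e) + 4 * m * q * (4 * m * q)) * (m * q) + (2 * (q * q * e) * (4 * m * q) + q * (q * q) * (21 * (m * m))) + 20 * m * m * (q * q * q)
  merge = solve-∀
  expand : ∀ p s r h → (2 * p + s * s) * r + (2 * p * s + h) ≡ p * s + s * p + p * r + s * s * r + p * r + h
  expand = solve-∀

-- The increment (1 + q)³ - q³ is at most 7q², hence at most q³/L once q ≥ 7L.
cube-growth : ∀ L q → 7 * L ≤ q → 1 ≤ q → L * (1 + q) ³ ≤ (1 + L) * (q * q * q)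
cube-growth L q 7L≤q 1≤q = begin
  L * (1 + q) ³                             ≡⟨ expand L q ⟩
  L * (q * q * q) + (3 * L * (q * q * 1) + 3 * L * (q * 1 * 1) + L * (1 * 1 * 1))
    ≤⟨ +-monoʳ-≤ (L * (q * q * q)) (+-mono-≤ (+-mono-≤ ≤-refl
         (*-monoʳ-≤ (3 * L) (*-monoˡ-≤ 1 (*-monoʳ-≤ q 1≤q)))) (*-monoʳ-≤ L (*-monoˡ-≤ 1 (*-mono-≤ 1≤q 1≤q)))) ⟩
  L * (q * q * q) + (3 * L * (q * q * 1) + 3 * L * (q * q * 1) + L * (q * q * 1))
    ≡⟨ collect L q ⟩
  L * (q * q * q) + 7 * L * (q * q)         ≤⟨ +-monoʳ-≤ (L * (q * q * q)) (*-monoˡ-≤ (q * q) 7L≤q) ⟩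
  L * (q * q * q) + q * (q * q)             ≡⟨ finish L q ⟩
  (1 + L) * (q * q * q)                     ∎
  where
  open ≤-Reasoning
  expand : ∀ L q → L * ((1 + q) * (1 + q) * (1 + q)) ≡ L * (q * q * q) + (3 * L * (q * q * 1) + 3 * L * (q * 1 * 1) + L * (1 * 1 * 1))
  expand = solve-∀
  collect : ∀ L q → L * (q * q * q) + (3 * L * (q * q * 1) + 3 * L * (q * q * 1) + L * (q * q * 1)) ≡ L * (q * q * q) + 7 * L * (q * q)
  collect = solve-∀
  finish : ∀ L q → L * (q * q * q) + q * (q * q) ≡ (1 + L) * (q * q * q)
  finish = solve-∀

-- Relative to (9mq)³/6 the edge bound is (192m + 2)/(243m), exceeding 64/81 by 2/(243m). Half of
-- this excess is spent on replacing 9mq by 9m(1 + q), since n need not be a multiple of 9m; the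
-- other half remains.
lower-arithmetic : ∀ {m q n c T} → 7 * (192 * m + 1) ≤ q → n ≤ 9 * m * (1 + q) → 6 * c ≤ n ³ →
  q * q * q * (m * m * (96 * m + 1)) ≤ T → (192 * m + 1) * c ≤ T * (243 * m)
lower-arithmetic {m} {q} {n} {c} {T} q≥ n≤ c≤ T≥ = *-cancelˡ-≤ 6 (begin
  6 * (L * c)
    ≡⟨ swap 6 L c ⟩
  L * (6 * c)
    ≤⟨ *-monoʳ-≤ L (≤-trans c≤ (*-mono-≤ (*-mono-≤ n≤ n≤) n≤)) ⟩
  L * (9 * m * (1 + q)) ³
    ≡⟨ regroup L m q ⟩
  729 * (m * m * m) * (L * (1 + q) ³)
    ≤⟨ *-monoʳ-≤ (729 * (m * m * m)) (cube-growth L q q≥ 1≤q) ⟩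
  729 * (m * m * m) * ((1 + L) * (q * q * q))
    ≡⟨ factor m q ⟩
  6 * (q * q * q * (m * m * (96 * m + 1)) * (243 * m))
    ≤⟨ *-monoʳ-≤ 6 (*-monoˡ-≤ (243 * m) T≥) ⟩
  6 * (T * (243 * m)) ∎)
  where
  open ≤-Reasoning
  L : ℕ
  L = 192 * m + 1
  1≤q : 1 ≤ q
  1≤q = ≤-trans (*-mono-≤ {1} {7} (s≤s z≤n) (m≤n+m 1 (192 * m))) q≥
  swap : ∀ a b c → a * (b * c) ≡ b * (a * c)
  swap = solve-∀
  regroup : ∀ L m q → L * (9 * m * (1 + q) * (9 * m * (1 + q)) * (9 * m * (1 + q))) ≡
                      729 * (m * m * m) * (L * ((1 + q) * (1 + q) * (1 + q)))
  regroup = solve-∀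
  factor : ∀ m q → 729 * (m * m * m) * ((1 + (192 * m + 1)) * (q * q * q)) ≡
                   6 * (q * q * q * (m * m * (96 * m + 1)) * (243 * m))
  factor = solve-∀

-- Turán densities

open import Data.Integer.Base as ℤ using (+_; +[1+_]; -[1+_])
import Data.Integer.Properties as ℤ
open import Data.Rational as ℚ using (ℚ; 0ℚ; mkℚ)
import Data.Rational.Properties as ℚ
open import Data.Rational.Unnormalised.Base as ℚᵘ using (mkℚᵘ; *≤*; *<*)
import Data.Rational.Unnormalised.Properties as ℚᵘ

frac : (p e : ℕ) .{{_ : NonZero e}} → ℚ
frac p e = + p ℚ./ e

toℚᵘ-frac : ∀ p q → ℚ.toℚᵘ (frac p (suc q)) ℚᵘ.≃ mkℚᵘ (+ p) q
toℚᵘ-frac p q = ℚ.toℚᵘ-fromℚᵘ (mkℚᵘ (+ p) q)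

toℚᵘ-frac-* : ∀ p q x → ℚ.toℚᵘ (frac p (suc q) ℚ.* ℕ→ℚ x) ℚᵘ.≃ mkℚᵘ (+ p) q ℚᵘ.* mkℚᵘ (+ x) 0
toℚᵘ-frac-* p q x =
  ℚᵘ.≃-trans (ℚ.toℚᵘ-homo-* (frac p (suc q)) (ℕ→ℚ x)) (ℚᵘ.*-cong (toℚᵘ-frac p q) (toℚᵘ-frac x 0))

frac-*-≤ : ∀ {p e x y} .{{_ : NonZero e}} → p * x ≤ y * e → frac p e ℚ.* ℕ→ℚ x ℚ.≤ ℕ→ℚ y
frac-*-≤ {p} {suc q} {x} {y} h = ℚ.toℚᵘ-cancel-≤
  (ℚᵘ.≤-respˡ-≃ (ℚᵘ.≃-sym (toℚᵘ-frac-* p q x)) (ℚᵘ.≤-respʳ-≃ (ℚᵘ.≃-sym (toℚᵘ-frac y 0))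
    (*≤* (subst₂ ℤ._≤_ (trans (ℤ.pos-* p x) (sym (ℤ.*-identityʳ _)))
      (trans (cong (λ t → + (y * t)) (sym (*-identityʳ (suc q)))) (ℤ.pos-* y (suc q * 1))) (ℤ.+≤+ h)))))

≤-frac-* : ∀ {p e x y} .{{_ : NonZero e}} → y * e ≤ p * x → ℕ→ℚ y ℚ.≤ frac p e ℚ.* ℕ→ℚ x
≤-frac-* {p} {suc q} {x} {y} h = ℚ.toℚᵘ-cancel-≤
  (ℚᵘ.≤-respˡ-≃ (ℚᵘ.≃-sym (toℚᵘ-frac y 0)) (ℚᵘ.≤-respʳ-≃ (ℚᵘ.≃-sym (toℚᵘ-frac-* p q x))
    (*≤* (subst₂ ℤ._≤_ (trans (cong (λ t → + (y * t)) (sym (*-identityʳ (suc q)))) (ℤ.pos-* y (suc q * 1)))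
      (trans (ℤ.pos-* p x) (sym (ℤ.*-identityʳ _))) (ℤ.+≤+ h)))))

frac-< : ∀ {p e p′ e′} .{{_ : NonZero e}} .{{_ : NonZero e′}} → p * e′ < p′ * e → frac p e ℚ.< frac p′ e′
frac-< {p} {suc q} {p′} {suc q′} h = ℚ.toℚᵘ-cancel-<
  (ℚᵘ.<-respˡ-≃ (ℚᵘ.≃-sym (toℚᵘ-frac p q)) (ℚᵘ.<-respʳ-≃ (ℚᵘ.≃-sym (toℚᵘ-frac p′ q′))
    (*<* (subst₂ ℤ._<_ (ℤ.pos-* p (suc q′)) (ℤ.pos-* p′ (suc q)) (ℤ.+<+ h)))))

frac-<-+ : ∀ {p e p′ e′ r s} .{{_ : NonZero e}} .{{_ : NonZero e′}} (c : ℚ) → ℚ.toℚᵘ c ≡ mkℚᵘ (+ r) s →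
  p * (e′ * suc s) < (p′ * suc s + r * e′) * e → frac p e ℚ.< frac p′ e′ ℚ.+ c
frac-<-+ {p} {suc q} {p′} {suc q′} {r} {s} c c≡ h = ℚ.toℚᵘ-cancel-<
  (ℚᵘ.<-respˡ-≃ (ℚᵘ.≃-sym (toℚᵘ-frac p q)) (ℚᵘ.<-respʳ-≃ (ℚᵘ.≃-sym sum≃)
    (*<* (subst₂ ℤ._<_ (ℤ.pos-* p (suc q′ * suc s))
      (trans (ℤ.pos-* (p′ * suc s + r * suc q′) (suc q))
        (cong (ℤ._* + suc q) (trans (ℤ.pos-+ (p′ * suc s) (r * suc q′))
          (cong₂ ℤ._+_ (ℤ.pos-* p′ (suc s)) (ℤ.pos-* r (suc q′))))))
      (ℤ.+<+ h)))))
  where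
  sum≃ : ℚ.toℚᵘ (frac p′ (suc q′) ℚ.+ c) ℚᵘ.≃ mkℚᵘ (+ p′) q′ ℚᵘ.+ mkℚᵘ (+ r) s
  sum≃ = ℚᵘ.≃-trans (ℚ.toℚᵘ-homo-+ (frac p′ (suc q′)) c)
    (ℚᵘ.+-cong (toℚᵘ-frac p′ q′) (ℚᵘ.≃-reflexive c≡))

dense : ℕ → ℕ → Family
dense k M m H = m ≡ k × M < ∣E∣ H

free-upper-bound : ∀ κ M j (G : Graph3 (j + (3 + κ))) → Free (dense (3 + κ) M) G →
  ∣E∣ G * ((3 + κ) * (2 + κ) * (1 + κ)) ≤ M * ((j + (3 + κ)) * (j + (2 + κ)) * (j + (1 + κ)))
free-upper-bound κ M j G free =
  subst (λ e → e * ((3 + κ) * (2 + κ) * (1 + κ)) ≤ M * ((j + (3 + κ)) * (j + (2 + κ)) * (j + (1 + κ))))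
    (#-listed (edges G) (unique G))
    (averaging κ M j (listed (edges G)) (listed-increasing G) local)
  where
  local : ∀ φ → StrictlyMonotone φ → # (pull (listed (edges G)) φ) ≤ M
  local φ mono = ≮⇒≥ λ M< → free (3 + κ , graphOf F inc , (refl , ≤-trans M< (≤-reflexive (sym (#-graphOf F inc)))) ,
    induced-⊆ G φ mono inc)
    where
    F : Relation₃ (3 + κ)
    F = pull (listed (edges G)) φ
    reflect : ∀ x y → φ x Fin.< φ y → x Fin.< y
    reflect x y lt with Fin.<-cmp x y
    ... | tri< x<y _ _    = x<y
    ... | tri≈ _ refl _   = contradiction lt (<-irrefl refl)
    ... | tri> _ _ y<x    = contradiction (mono y x y<x) (<-asym lt)
    inc : IsIncreasing F
    inc x y z h with xy , yz ← listed-increasing G (φ x) (φ y) (φ z) h = reflect x y xy , reflect y z yz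

blow-up-free : ∀ {Q} → 2 ≤ Q → ∀ q r k {D} → (∀ x → 486 * x ≤ 64 * k ³ → x ≤ D) →
  (M : Relation₃ Q) (inc : IsIncreasing M) → Sparse k M →
  Free (dense k D) (graphOf (blow-up Q q r M) (blow-up-increasing Q q r M inc))
blow-up-free 2≤Q q r k below M inc sparse (_ , H , (refl , D<) , H⊆)
  with Q , refl ← m≤n⇒∃[o]m+o≡n 2≤Q
  with φ , H≤ ← subgraph-bound (blow-up (2 + Q) q r M) (blow-up-increasing (2 + Q) q r M inc) H H⊆ =
  <⇒≱ D< (≤-trans H≤ (below _ (labelling-bound M inc sparse (blocks (2 + Q) q r ∘ φ))))

pairs-4m : ∀ m → e₂ {4 * m} (λ _ → 1) + 2 * m ≡ 8 * (m * m)
pairs-4m m = *-cancelˡ-≡ _ _ 2 (via (e₂ {4 * m} (λ _ → 1)) (trans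
  (cong (λ s → 2 * e₂ {4 * m} (λ _ → 1) + s) (sym ones))
  (trans (square-of-sum {4 * m} (λ _ → 1)) (cong₂ _*_ ones ones))))
  where
  ones : ∑[ u < 4 * m ] 1 ≡ 4 * m
  ones = trans (∑-const (4 * m) 1) (*-identityʳ (4 * m))
  via : ∀ e → 2 * e + 4 * m ≡ 4 * m * (4 * m) → 2 * (e + 2 * m) ≡ 2 * (8 * (m * m))
  via e eq = trans (left e m) (trans eq (right m))
    where
    left : ∀ e m → 2 * (e + 2 * m) ≡ 2 * e + 4 * m
    left = solve-∀
    right : ∀ m → 4 * m * (4 * m) ≡ 2 * (8 * (m * m))
    right = solve-∀

free-lower-bound : ∀ m k {D} → 1 ≤ m → (∀ x → 486 * x ≤ 64 * k ³ → x ≤ D) →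
  (∃ λ (M : Relation₃ (4 * m)) → IsIncreasing M × Sparse k M × 21 * (m * m) ≤ # M) →
  ∀ n → 9 * m * (7 * (192 * m + 1)) ≤ n →
  Σ (Graph3 n) λ G → Free (dense k D) G × (192 * m + 1) * (n C 3) ≤ ∣E∣ G * (243 * m)
free-lower-bound m k {D} 1≤m below (M , inc , sparse , large) n n≥ =
  subst (λ n → Σ (Graph3 n) λ G → Free (dense k D) G × (192 * m + 1) * (n C 3) ≤ ∣E∣ G * (243 * m))
    (sym n≡) (G , blow-up-free 2≤4m q r k below M inc sparse , bound)
  where
  instance
    9m≢0 : NonZero (9 * m)
    9m≢0 = >-nonZero (*-mono-≤ {1} {9} (s≤s z≤n) 1≤m)
  q r : ℕ
  q = n DivMod./ (9 * m)
  -- The remainder of n modulo 9m is put into C, where it only adds edges.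
  r = m * q + n % (9 * m)
  2≤4m : 2 ≤ 4 * m
  2≤4m = *-mono-≤ {2} {4} {1} {m} (s≤s (s≤s z≤n)) 1≤m
  regroup : ∀ s m q → s + q * (9 * m) ≡ 4 * m * q + (4 * m * q + (m * q + s))
  regroup = solve-∀
  n≡ : n ≡ 4 * m * q + (4 * m * q + r)
  n≡ = trans (m≡m%n+[m/n]*n n (9 * m)) (regroup (n % (9 * m)) m q)
  G : Graph3 (4 * m * q + (4 * m * q + r))
  G = graphOf (blow-up (4 * m) q r M) (blow-up-increasing (4 * m) q r M inc)
  q≥ : 7 * (192 * m + 1) ≤ q
  q≥ = ≤-trans (≤-reflexive (sym (DivMod.m*n/n≡m (7 * (192 * m + 1)) (9 * m))))
    (DivMod./-monoˡ-≤ (9 * m) (≤-trans (≤-reflexive (*-comm (7 * (192 * m + 1)) (9 * m))) n≥))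
  n≤ : n ≤ 9 * m * (1 + q)
  n≤ = ≤-trans (≤-reflexive (m≡m%n+[m/n]*n n (9 * m)))
    (≤-trans (+-monoˡ-≤ (q * (9 * m)) (<⇒≤ (m%n<n n (9 * m)))) (≤-reflexive (*-comm (1 + q) (9 * m))))
  3≤n : 3 ≤ n
  3≤n = ≤-trans (*-mono-≤ {3} {9 * m} {1} (≤-trans (m≤m+n 3 6) (*-mono-≤ {9} {9} ≤-refl 1≤m))
    (*-mono-≤ {1} {7} (s≤s z≤n) (m≤n+m 1 (192 * m)))) n≥
  edges≥ : q * q * q * (m * m * (96 * m + 1)) ≤ ∣E∣ G
  edges≥ = ≤-trans (blow-up-arithmetic {m} {q} {r} {e₂ {4 * m} (λ _ → 1)} {# M} (pairs-4m m) (m≤m+n (m * q) _) large)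
    (≤-reflexive (sym (trans (#-graphOf (blow-up (4 * m) q r M) (blow-up-increasing (4 * m) q r M inc))
      (blow-up-# (4 * m) q r M))))
  bound : (192 * m + 1) * ((4 * m * q + (4 * m * q + r)) C 3) ≤ ∣E∣ G * (243 * m)
  bound = subst (λ t → (192 * m + 1) * (t C 3) ≤ ∣E∣ G * (243 * m)) n≡
    (lower-arithmetic {m} {q} {n} {n C 3} {∣E∣ G} q≥ n≤ (6*nC3≤n³ n 3≤n) edges≥)

≤⇒∃ : ∀ {m n} → m ≤ n → ∃ λ j → j + m ≡ n
≤⇒∃ {m} {n} m≤n = n ∸ m , m∸n+n≡m m≤n

m<m+ : ∀ x {y z} → x + suc y ≡ z → x < z
m<m+ x {y} eq = ≤-trans (m<m+n x z<s) (≤-reflexive eq)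

α<a : ∀ m .{{_ : NonZero (243 * m)}} → frac 64 81 ℚ.< frac (192 * m + 1) (243 * m)
α<a m = frac-< {64} {81} {192 * m + 1} {243 * m} (m<m+ (64 * (243 * m)) {80} (eq m))
  where
  eq : ∀ m → 64 * (243 * m) + 81 ≡ (192 * m + 1) * 81
  eq = solve-∀

a<b : ∀ m D .{{_ : NonZero (243 * m)}} .{{_ : NonZero (162 * D)}} → 1 ≤ m → D ≤ m →
  frac (192 * m + 1) (243 * m) ℚ.< frac (128 * D + 81) (162 * D)
a<b m D 1≤m D≤m = frac-< {192 * m + 1} {243 * m} {128 * D + 81} {162 * D} (begin-strict
  (192 * m + 1) * (162 * D)                    ≡⟨ left m D ⟩
  31104 * (m * D) + 162 * D                    ≤⟨ +-monoʳ-≤ (31104 * (m * D)) (*-monoʳ-≤ 162 D≤m) ⟩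
  31104 * (m * D) + 162 * m                    <⟨ m<m+n (31104 * (m * D) + 162 * m) (*-mono-≤ {1} {19521} (s≤s z≤n) 1≤m) ⟩
  31104 * (m * D) + 162 * m + 19521 * m        ≡⟨ right m D ⟩
  (128 * D + 81) * (243 * m)                   ∎)
  where
  open ≤-Reasoning
  left : ∀ m d → (192 * m + 1) * (162 * d) ≡ 31104 * (m * d) + 162 * d
  left = solve-∀
  right : ∀ m d → 31104 * (m * d) + 162 * m + 19521 * m ≡ (128 * d + 81) * (243 * m)
  right = solve-∀

-- The numerator of c is at least 1, so c ≥ 1/(1 + d), twice the excess 1/(2(1 + d)) of the upper
-- bound. Hence k may be chosen from the denominator of c alone.
b<α+c : ∀ d r .{{_ : NonZero (162 * suc d)}} c → ℚ.toℚᵘ c ≡ mkℚᵘ (+ suc r) d →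
  frac (128 * suc d + 81) (162 * suc d) ℚ.< frac 64 81 ℚ.+ c
b<α+c d r c c≡ = frac-<-+ {128 * suc d + 81} {162 * suc d} {64} {81} c c≡
  (≤-trans (m<m+n ((128 * suc d + 81) * (81 * suc d)) {81 * (suc d * (1 + 2 * r)) * 81} positive) (≤-reflexive (eq (suc d) r)))
  where
  positive : 0 < 81 * (suc d * (1 + 2 * r)) * 81
  positive = *-mono-≤ {1} {81 * (suc d * (1 + 2 * r))} {1} {81} (*-mono-≤ {1} {81} (s≤s z≤n) (*-mono-≤ {1} {suc d} {1} {1 + 2 * r} (s≤s z≤n) (s≤s z≤n))) (s≤s z≤n)
  eq : ∀ D r → (128 * D + 81) * (81 * D) + 81 * (D * (1 + 2 * r)) * 81 ≡
               (64 * D + (1 + r) * 81) * (162 * D)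
  eq = solve-∀

dense-upper-density : ∀ d {X} → 486 * X ≤ 64 * (3 + (7 + 8 * d)) ³ → .{{_ : NonZero (162 * suc d)}} →
  ∀ n → 3 + (7 + 8 * d) ≤ n → (G : Graph3 n) → Free (dense (3 + (7 + 8 * d)) X) G →
  ℕ→ℚ (∣E∣ G) ℚ.≤ frac (128 * suc d + 81) (162 * suc d) ℚ.* ℕ→ℚ (n C 3)
dense-upper-density d {X} X≤ n k≤n G free = at (≤⇒∃ k≤n) G free
  where
  at : ∀ {n} → (∃ λ j → j + (3 + (7 + 8 * d)) ≡ n) → (G : Graph3 n) → Free (dense (3 + (7 + 8 * d)) X) G →
    ℕ→ℚ (∣E∣ G) ℚ.≤ frac (128 * suc d + 81) (162 * suc d) ℚ.* ℕ→ℚ (n C 3)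
  at (j , refl) G free = ≤-frac-* {128 * suc d + 81} {162 * suc d} {(j + (3 + (7 + 8 * d))) C 3} {∣E∣ G}
    (upper-arithmetic d {∣E∣ G} {X} {(j + (3 + (7 + 8 * d))) C 3}
    (free-upper-bound (7 + 8 * d) X j G free) (6*nC3 j (7 + 8 * d)) X≤)

dense-lower-density : ∀ m k {X} .{{_ : NonZero (243 * m)}} → 1 ≤ m → (∀ x → 486 * x ≤ 64 * k ³ → x ≤ X) →
  (∃ λ (M : Relation₃ (4 * m)) → IsIncreasing M × Sparse k M × 21 * (m * m) ≤ # M) →
  ∀ n → 9 * m * (7 * (192 * m + 1)) ≤ n →
  Σ (Graph3 n) λ G → Free (dense k X) G × frac (192 * m + 1) (243 * m) ℚ.* ℕ→ℚ (n C 3) ℚ.≤ ℕ→ℚ (∣E∣ G)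
dense-lower-density m k 1≤m ≤X sparse n n≥ =
  let G , free , bound = free-lower-bound m k 1≤m ≤X sparse n n≥ in
  G , free , frac-*-≤ {192 * m + 1} {243 * m} {n C 3} {∣E∣ G} bound

-- The two bounds are 64/81 + 1/(243m) and 64/81 + 1/(2(1 + d)).
non-jump : ∀ d m → 1 ≤ m → suc d ≤ m →
  (∃ λ (M : Relation₃ (4 * m)) → IsIncreasing M × Sparse (3 + (7 + 8 * d)) M × 21 * (m * m) ≤ # M) →
  ∀ r c → ℚ.toℚᵘ c ≡ mkℚᵘ (+ suc r) d →
  Σ Family λ 𝓕 → TuranDensityIn 𝓕 (frac 64 81) (frac 64 81 ℚ.+ c)
non-jump d m 1≤m D≤m sparse r c c≡ =
  dense k X , frac (192 * m + 1) (243 * m) , frac (128 * suc d + 81) (162 * suc d) ,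
  α<a m , a<b m (suc d) 1≤m D≤m , b<α+c d r c c≡ , k + 9 * m * (7 * (192 * m + 1)) ,
  λ n n≥ → dense-lower-density m k 1≤m ≤X sparse n (m+n≤o⇒n≤o k n≥) ,
           dense-upper-density d X≤ n (m+n≤o⇒m≤o k n≥)
  where
  k X : ℕ
  k = 3 + (7 + 8 * d)
  -- The floor of (64/81)k³/6 serves both sides: the blow-ups never exceed it on k vertices, and
  -- averaging starts from it.
  X = 64 * k ³ DivMod./ 486
  instance
    m≢0 : NonZero m
    m≢0 = >-nonZero 1≤m
    243m≢0 : NonZero (243 * m)
    243m≢0 = m*n≢0 243 m
    162D≢0 : NonZero (162 * suc d)
    162D≢0 = m*n≢0 162 (suc d)
  X≤ : 486 * X ≤ 64 * k ³
  X≤ = ≤-trans (≤-reflexive (*-comm 486 X)) (DivMod.m/n*n≤m (64 * k ³) 486)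
  ≤X : ∀ x → 486 * x ≤ 64 * k ³ → x ≤ X
  ≤X x h = ≤-trans (≤-reflexive (sym (DivMod.m*n/n≡m x 486)))
    (DivMod./-monoˡ-≤ 486 (≤-trans (≤-reflexive (*-comm x 486)) h))

-- A separate lemma, so that the threshold q₀ is a variable and is never computed.
non-jump-from : ∀ d r c → ℚ.toℚᵘ c ≡ mkℚᵘ (+ suc r) d →
  (∃ λ q₀ → ∀ q → q₀ ≤ q → let m = 11 + q in
    ∃ λ (M : Relation₃ (4 * m)) → IsIncreasing M × Sparse (3 + (7 + 8 * d)) M × 21 * (m * m) ≤ # M) →
  Σ Family λ 𝓕 → TuranDensityIn 𝓕 (frac 64 81) (frac 64 81 ℚ.+ c)
non-jump-from d r c c≡ (q₀ , sparse) =
  -- The summand q₀ reaches the threshold for sparse systems; d gives `suc d ≤ m`, which separates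
  -- the excesses 1/(243m) and 1/(2(1 + d)).
  non-jump d (11 + (q₀ + d)) (s≤s z≤n) (s≤s (≤-trans (m≤n+m d q₀) (m≤n+m (q₀ + d) 10)))
    (sparse (q₀ + d) (m≤m+n q₀ d)) r c c≡

theorem1p5 : (c : ℚ) → 0ℚ ℚ.< c →
    Σ Family λ 𝓕 → TuranDensityIn 𝓕 (+ 64 ℚ./ 81) ((+ 64 ℚ./ 81) ℚ.+ c)
theorem1p5 c@(mkℚ +[1+ r ] d _) _ = non-jump-from d r c refl (sparse-exists (3 + (7 + 8 * d)))
theorem1p5 (mkℚ (+ 0) d _) 0<c = contradiction (ℚ.positive 0<c) λ ()
theorem1p5 (mkℚ -[1+ r ] d _) 0<c = contradiction (ℚ.positive 0<c) λ ()
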